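{- If a covering $\mathcal{C}$ of $\mathbb{R}^2$ by complete folding curves satisfies the local isomorphism property, then $\mathcal{C}$ consists of at most $6$ curves.
   Context: All sequences take values in $\{+1,-1\}$. For a finite sequence $S=(a_1,\dots,a_n)$ write $\overline{S}=(-a_n,\dots,-a_1)$. The $n$-folding sequences are defined recursively: the only $0$-folding sequence is the empty sequence, and the $(n+1)$-folding sequences are exactly $(\overline{S},+1,S)$ and $(\overline{S},-1,S)$ with $S$ an $n$-folding sequence. A subword of a sequence $(b_k)$ is a block $(b_{h+1},\dots,b_{h+m})$. A complete folding sequence is a sequence $(a_k)_{k\in\mathbb{Z}}$ each finite subword of which is a subword of some $n$-folding sequence. A segment is an oriented unit edge of $\mathbb{Z}^2$ (ordered pair $(X,Y)$ of lattice points at distance $1$; its support is the edge $[X,Y]$). A complete curve is a sequence $(C_i)_{i\in\mathbb{Z}}$ of segments such that the terminal point of $C_i$ is the initial point of $C_{i+1}$, consecutive supports are perpendicular, and all supports are pairwise distinct (curves differing by an index shift are identified). Its associated sequence is $(\eta_i)_{i\in\mathbb{Z}}$ with $\eta_i=+1$ (resp. $-1$) if one turns left (resp. right) from $C_i$ to $C_{i+1}$. A complete folding curve is a complete curve whose associated sequence is a complete folding sequence. A covering of $\mathbb{R}^2$ by complete folding curves is a set $\mathcal{C}$ of complete folding curves such that every unit edge of the lattice $\mathbb{Z}^2$ is the support of exactly one segment of exactly one curve of $\mathcal{C}$. A decorated segment of $\mathcal{C}$ is a segment of a curve of $\mathcal{C}$ together with, at each of its endpoints, the support of the segment of the same curve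 which precedes/follows it there. $\mathcal{C}$ satisfies the local isomorphism property if for every finite set $F$ of decorated segments of $\mathcal{C}$ there is $r>0$ such that every disk of radius $r$ in $\mathbb{R}^2$ contains a translate $v+F$ ($v\in\mathbb{Z}^2$) which is a set of decorated segments of $\mathcal{C}$. -}

module Defs where

open import Data.Nat using (ℕ; zero; suc)
open import Data.Integer using (ℤ; +_; _+_; _-_; _*_; _≤_)
open import Data.Sign using (Sign; opposite) renaming (+ to plus; - to minus)
open import Data.List using (List; []; _∷_; _++_; map; reverse; upTo)
open import Data.List.Relation.Unary.All using (All)
open import Data.Product using (_×_; _,_; Σ; ∃; proj₁; proj₂)
open import Data.Fin using (Fin)
open import Function.Definitions using (Injective)
open import Relation.Binary.PropositionalEquality using (_≡_; _≢_)
open import Relation.Nullary using (¬_)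

bar : List Sign → List Sign
bar S = map opposite (reverse S)

data IsFolding : ℕ → List Sign → Set where
  fold0 : IsFolding zero []
  foldS : ∀ {n S} → IsFolding n S → (s : Sign) → IsFolding (suc n) (bar S ++ s ∷ S)

IsSubword : List Sign → List Sign → Set
IsSubword w S = Σ (List Sign) λ u → Σ (List Sign) λ v → S ≡ u ++ w ++ v

window : (ℤ → Sign) → ℤ → ℕ → List Sign
window a h m = map (λ j → a (h + + suc j)) (upTo m)

IsCompleteFoldingSequence : (ℤ → Sign) → Set
IsCompleteFoldingSequence a =
  ∀ (h : ℤ) (m : ℕ) → Σ ℕ λ n → Σ (List Sign) λ S → IsFolding n S × IsSubword (window a h m) S

Point : Set
Point = ℤ × ℤ

data Dir : Set where
  east north west south : Dir

step : Dir → Point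
step east  = (+ 1 , + 0)
step north = (+ 0 , + 1)
step west  = (Data.Integer.- (+ 1) , + 0)
step south = (+ 0 , Data.Integer.- (+ 1))

_⊕_ : Point → Point → Point
(a , b) ⊕ (c , d) = (a + c , b + d)

rotL : Dir → Dir
rotL east  = north
rotL north = west
rotL west  = south
rotL south = east

rotR : Dir → Dir
rotR east  = south
rotR south = west
rotR west  = north
rotR north = east

Segment : Set
Segment = Point × Dir

initial : Segment → Point
initial = proj₁

terminal : Segment → Point
terminal (p , d) = p ⊕ step d

-- Unoriented unit edges: lower/left endpoint together with orientation
data Axis : Set where
  horiz vert : Axis

Edge : Set
Edge = Point × Axis

support : Segment → Edge
support (p , east)  = (p , horiz)
support (p , north) = (p , vert)
support (p , west)  = (p ⊕ step west , horiz)
support (p , south) = (p ⊕ step south , vert)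

Perp : Dir → Dir → Set
Perp d d' = (d' ≡ rotL d) Data.Sum.⊎ (d' ≡ rotR d)
  where import Data.Sum

turn : Dir → Dir → Sign
turn east  north = plus
turn north west  = plus
turn west  south = plus
turn south east  = plus
turn _     _     = minus

record CompleteCurve : Set where
  field
    seg      : ℤ → Segment
    chained  : ∀ i → terminal (seg i) ≡ initial (seg (i + + 1))
    perp     : ∀ i → Perp (proj₂ (seg i)) (proj₂ (seg (i + + 1)))
    distinct : ∀ i j → i ≢ j → support (seg i) ≢ support (seg j)

  assoc : ℤ → Sign
  assoc i = turn (proj₂ (seg i)) (proj₂ (seg (i + + 1)))

IsCompleteFoldingCurve : CompleteCurve → Set
IsCompleteFoldingCurve c = IsCompleteFoldingSequence (CompleteCurve.assoc c)

-- Coverings: a family of complete folding curves indexed by a type I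
-- such that every unit edge is the support of exactly one segment of
-- exactly one curve (this also forces distinct indices to give
-- distinct curves, even up to index shift).

record Covering (I : Set) : Set where
  field
    curve   : I → CompleteCurve
    folding : ∀ i → IsCompleteFoldingCurve (curve i)
    cover   : ∀ (e : Edge) → Σ I λ i → Σ ℤ λ k → support (CompleteCurve.seg (curve i) k) ≡ e
    unique  : ∀ i j k l →
              support (CompleteCurve.seg (curve i) k) ≡ support (CompleteCurve.seg (curve j) l) →
              (i ≡ j) × (k ≡ l)

DecSeg : Set
DecSeg = Segment × Edge × Edge

decorated : CompleteCurve → ℤ → DecSeg
decorated c k = (seg k , support (seg (k - + 1)) , support (seg (k + + 1)))
  where open CompleteCurve c

IsDecSegOf : ∀ {I} → Covering I → DecSeg → Set
IsDecSegOf {I} C D = Σ I λ i → Σ ℤ λ k → decorated (Covering.curve C i) k ≡ D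

translateE : Point → Edge → Edge
translateE v (p , a) = (v ⊕ p , a)

translateD : Point → DecSeg → DecSeg
translateD v ((p , d) , e₁ , e₂) = ((v ⊕ p , d) , translateE v e₁ , translateE v e₂)

InDisk : Point → ℕ → Point → Set
InDisk (x , y) r (a , b) = (a - x) * (a - x) + (b - y) * (b - y) ≤ + r * + r

DecInDisk : Point → ℕ → DecSeg → Set
DecInDisk x r (s , _ , _) = InDisk x r (initial s) × InDisk x r (terminal s)

LocalIsomorphism : ∀ {I} → Covering I → Set
LocalIsomorphism C =
  ∀ (F : List DecSeg) → All (IsDecSegOf C) F →
  Σ ℕ λ r → (1 Data.Nat.≤ r) ×
    (∀ (x : Point) → Σ Point λ v →
       All (λ D → IsDecSegOf C (translateD v D) × DecInDisk x r (translateD v D)) F)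

AtMost : ℕ → Set → Set
AtMost n I = ∀ (f : Fin (suc n) → I) → ¬ Injective _≡_ _≡_ f

{-# OPTIONS --safe #-}
-- A window of a complete folding curve is a window of a walk whose turns are a
-- paperfolding sequence.  Keeping every fourth vertex of such a walk gives, at
-- scale 2, another such walk; the fine walk is recovered from the coarse one by a
-- rule depending only on the direction of each coarse segment.
--
-- Two consequences.  (1) Long windows of the walk fill arbitrarily large squares:
-- a full square of side w ≥ 3 in the coarse walk gives one of side 2w − 2 in the
-- fine walk, and six coarsenings down a single segment fills a square of side 3.
-- (2) Vertices in a square of side 2^M + 1 coarsen to vertices in a square of
-- side 2^(M−1) + 1, and finally in a 3 × 3 block of lattice points.  Along a walk
-- the parity of the initial point decides whether a segment is horizontal, so only
-- 6 of the 12 edges at the boundary of such a block can be traversed outwards;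
-- hence at most 6 long windows with pairwise distinct segments can meet it.
--
-- Given 7 curves, local isomorphism translates long windows of all of them into a
-- square filled by a single one of the curves, contradicting (2) for that curve.
module Submission where

open import Defs
open import Algebra.Bundles using (AbelianGroup)
open import Data.Bool using (Bool; true; false; not; _xor_; if_then_else_; T)
import Data.Bool.Properties as Boolₚ
open import Data.Bool.Properties using (not-involutive; xor-assoc; xor-comm; xor-identityʳ; not-distribˡ-xor)
open import Data.Empty using (⊥)
import Data.Fin as Fin
open import Data.Fin using (Fin; zero; suc; toℕ; combine)
open import Data.Fin.Patterns
import Data.Fin.Properties as Finₚ
import Data.Integer as ℤ
open import Data.Integer using (ℤ; +_; -[1+_]; _+_; _-_; _*_; 0ℤ; 1ℤ; -1ℤ; ∣_∣; _⊖_)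
open import Data.Integer.DivMod using (_/ℕ_; _%ℕ_; a≡a%ℕn+[a/ℕn]*n; n%ℕd<d)
import Data.Integer.Properties as ℤₚ
open import Algebra.Properties.Group (AbelianGroup.group ℤₚ.+-0-abelianGroup) using (∙-cancelˡ; ∙-cancelʳ)
open import Data.Integer.Tactic.RingSolver using (solve-∀)
open import Data.List using (List; []; _∷_; _++_; length; map; reverse; upTo; applyUpTo; tabulate; concat; replicate; cartesianProductWith)
open import Data.List.Membership.Propositional using (_∈_; find; lose)
open import Data.List.Membership.Propositional.Properties using (∈-++⁺ˡ; ∈-++⁺ʳ; ∈-cartesianProductWith⁺; ∈-upTo⁺; ∈-map⁺)
open import Data.List.Properties using (unfold-reverse; length-reverse; length-map; map-++; ++-assoc; map-applyUpTo; length-replicate)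
open import Data.List.Relation.Unary.All as All using (All; []; _∷_)
import Data.List.Relation.Unary.All.Properties as Allₚ
open import Data.List.Relation.Unary.Any as Any using (Any; here; there)
open import Data.Nat using (ℕ; zero; suc; _^_; _∸_; _<_; s≤s; z≤n; _≤ᵇ_) renaming (_*_ to _*ⁿ_; _+_ to _+ⁿ_; _≤_ to _≤ⁿ_)
open import Data.Nat.DivMod using (_divMod_; result)
import Data.Nat.Properties as ℕₚ
import Data.Nat.Tactic.RingSolver as ℕSolver
open import Data.Product using (Σ; _×_; _,_; proj₁; proj₂)
open import Data.Product.Properties using (,-injective; ≡-dec)
open import Data.Sign using (Sign; opposite) renaming (+ to plus; - to minus)
open import Data.Sign.Properties using (opposite-involutive)
open import Data.Sum using (_⊎_; inj₁; inj₂)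
open import Data.Unit using (⊤; tt)
open import Function using (_∘_; id)
open import Function.Definitions using (Injective)
open import Relation.Binary using (DecidableEquality)
open import Relation.Binary.PropositionalEquality
open import Relation.Nullary using (¬_; Dec; yes; no; contradiction)
open import Relation.Nullary.Decidable using (_⊎-dec_; _×-dec_; ¬?; map′; toWitness)

-- Paperfolding sequences

interleave : ∀ {A : Set} → (ℕ → A) → (ℕ → A) → ℕ → A
interleave g h zero    = g zero
interleave g h (suc k) = interleave h (g ∘ suc) k

alternate : Sign → ℕ → Sign
alternate s zero    = s
alternate s (suc k) = alternate (opposite s) k

-- The folds are listed from the last one to the first; turns are numbered from 1, so the value at 0 is junk.
paper : List Sign → ℕ → Sign
paper []       _ = plus
paper (s ∷ ss)   = interleave (paper ss) (alternate s)

weave : Sign → List Sign → List Sign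
weave s []       = s ∷ []
weave s (x ∷ xs) = s ∷ x ∷ weave (opposite s) xs

alternate-opposite : ∀ s k → alternate (opposite s) k ≡ opposite (alternate s k)
alternate-opposite s zero    = refl
alternate-opposite s (suc k) = alternate-opposite (opposite s) k

alternate-twice : ∀ s k → alternate (alternate s k) k ≡ s
alternate-twice s zero    = refl
alternate-twice s (suc k) = begin
  alternate (opposite (alternate (opposite s) k)) k
    ≡⟨ alternate-opposite (alternate (opposite s) k) k ⟩
  opposite (alternate (alternate (opposite s) k) k)
    ≡⟨ cong opposite (alternate-twice (opposite s) k) ⟩
  opposite (opposite s)
    ≡⟨ opposite-involutive s ⟩
  s ∎
  where open ≡-Reasoning

weave-++ : ∀ s X t Y → weave s X ++ t ∷ weave (alternate s (suc (length X))) Y ≡ weave s (X ++ t ∷ Y)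
weave-++ s []       t Y = refl
weave-++ s (x ∷ X) t Y = cong (λ l → s ∷ x ∷ l) (weave-++ (opposite s) X t Y)

bar-∷ : ∀ x S → bar (x ∷ S) ≡ bar S ++ opposite x ∷ []
bar-∷ x S = trans (cong (map opposite) (unfold-reverse x S)) (map-++ opposite (reverse S) (x ∷ []))

length-bar : ∀ S → length (bar S) ≡ length S
length-bar S = trans (length-map opposite (reverse S)) (length-reverse S)

-- Reversal brings the last woven sign, `alternate s (length S)`, to the front and negation flips
-- it. The woven signs alternate in either direction of reading.
bar-weave : ∀ s S → bar (weave s S) ≡ weave (opposite (alternate s (length S))) (bar S)
bar-weave s []      = refl
bar-weave s (x ∷ S) = begin
  bar (s ∷ x ∷ weave (opposite s) S)
    ≡⟨ bar-∷ s (x ∷ weave (opposite s) S) ⟩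
  bar (x ∷ weave (opposite s) S) ++ opposite s ∷ []
    ≡⟨ cong (_++ opposite s ∷ []) (bar-∷ x (weave (opposite s) S)) ⟩
  (bar (weave (opposite s) S) ++ opposite x ∷ []) ++ opposite s ∷ []
    ≡⟨ ++-assoc (bar (weave (opposite s) S)) (opposite x ∷ []) (opposite s ∷ []) ⟩
  bar (weave (opposite s) S) ++ opposite x ∷ opposite s ∷ []
    ≡⟨ cong (_++ opposite x ∷ opposite s ∷ []) (bar-weave (opposite s) S) ⟩
  weave u (bar S) ++ opposite x ∷ opposite s ∷ []
    ≡⟨ cong (λ z → weave u (bar S) ++ opposite x ∷ z ∷ []) (sym last) ⟩
  weave u (bar S) ++ opposite x ∷ weave (alternate u (suc (length (bar S)))) []
    ≡⟨ weave-++ u (bar S) (opposite x) [] ⟩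
  weave u (bar S ++ opposite x ∷ [])
    ≡⟨ cong (weave u) (sym (bar-∷ x S)) ⟩
  weave u (bar (x ∷ S)) ∎
  where
  open ≡-Reasoning
  u = opposite (alternate (opposite s) (length S))
  last : alternate u (suc (length (bar S))) ≡ opposite s
  last = begin
    alternate (opposite u) (length (bar S))
      ≡⟨ cong₂ alternate (opposite-involutive _) (length-bar S) ⟩
    alternate (alternate (opposite s) (length S)) (length S)
      ≡⟨ alternate-twice (opposite s) (length S) ⟩
    opposite s ∎

-- `foldS` builds a sequence around its middle turn, whereas coarsening removes the alternating
-- turns at odd positions. By induction both halves around the middle turn are weaves, and their
-- alternations fit together across it.
unweave : ∀ {n S} → IsFolding (suc n) S → Σ Sign λ s → Σ (List Sign) λ S' → IsFolding n S' × S ≡ weave s S'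
unweave (foldS fold0 s) = s , [] , fold0 , refl
unweave (foldS (foldS F t) s) with unweave (foldS F t)
... | r , S' , F' , eq =
  u , bar S' ++ s ∷ S' , foldS F' s ,
  trans (cong (λ X → bar X ++ s ∷ X) eq)
    (trans (cong₂ (λ X z → X ++ s ∷ weave z S') (bar-weave r S') (sym back))
           (weave-++ u (bar S') s S'))
  where
  u = opposite (alternate r (length S'))
  -- The signs woven into the left half end with `opposite r`, so those of the right half, starting
  -- with `r`, continue the alternation.
  back : alternate u (suc (length (bar S'))) ≡ r
  back = trans (cong₂ alternate (opposite-involutive _) (length-bar S')) (alternate-twice r (length S'))

Agree : (ℕ → Sign) → List Sign → Set
Agree f []       = ⊤
Agree f (x ∷ xs) = x ≡ f 0 × Agree (f ∘ suc) xs

-- Dropping the junk value at 0 exchanges the two interleaved sequences, whence the order of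
-- arguments here compared with `paper`.
agree-weave : ∀ s g S → Agree g S → Agree (interleave (alternate s) g) (weave s S)
agree-weave s g []      _       = refl , tt
agree-weave s g (x ∷ S) (e , a) = refl , e , agree-weave (opposite s) (g ∘ suc) S a

-- The folds of `S` come first in `ss`, followed by `pad`. Padding affects only turns at multiples
-- of 2^n, outside the 2^n - 1 turns of `S`, and it supplies the folds that repeated coarsening
-- consumes.
folding-paper : ∀ {n S} (pad : List Sign) → IsFolding n S →
  Σ (List Sign) λ ss → length pad ≤ⁿ length ss × Agree (paper ss ∘ suc) S
folding-paper {zero}  pad fold0 = pad , ℕₚ.≤-refl , tt
folding-paper {suc n} pad F with unweave F
... | s , S' , F' , refl with folding-paper pad F'
...   | ss , le , a = s ∷ ss , ℕₚ.m≤n⇒m≤1+n le , agree-weave s (paper ss ∘ suc) S' a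

agree-suffix : ∀ f u {w} → Agree f (u ++ w) → Agree (λ j → f (length u +ⁿ j)) w
agree-suffix f []      a       = a
agree-suffix f (_ ∷ u) (_ , a) = agree-suffix (f ∘ suc) u a

agree-prefix : ∀ f w {v} → Agree f (w ++ v) → Agree f w
agree-prefix f []      _       = tt
agree-prefix f (_ ∷ w) (e , a) = e , agree-prefix (f ∘ suc) w a

agree-applyUpTo : ∀ f g m → Agree f (applyUpTo g m) → ∀ {j} → j < m → g j ≡ f j
agree-applyUpTo f g (suc m) (e , _) {zero}  _            = e
agree-applyUpTo f g (suc m) (_ , a) {suc j} (s≤s lt) = agree-applyUpTo (f ∘ suc) (g ∘ suc) m a lt

paper-0 : ∀ s t ss j → paper (s ∷ t ∷ ss) (j *ⁿ 4) ≡ paper ss j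
paper-0 s t ss = go (paper ss) (alternate t) (alternate s)
  where
  go : ∀ (g h h' : ℕ → Sign) j → interleave (interleave g h) h' (j *ⁿ 4) ≡ g j
  go g h h' zero    = refl
  go g h h' (suc j) = go (g ∘ suc) (h ∘ suc) (h' ∘ (2 +ⁿ_)) j

paper-2 : ∀ s t ss j → paper (s ∷ t ∷ ss) (2 +ⁿ j *ⁿ 4) ≡ alternate t j
paper-2 s t ss = go (paper ss) (alternate t) (alternate s)
  where
  go : ∀ (g h h' : ℕ → Sign) j → interleave (interleave g h) h' (2 +ⁿ j *ⁿ 4) ≡ h j
  go g h h' zero    = refl
  go g h h' (suc j) = go (g ∘ suc) (h ∘ suc) (h' ∘ (2 +ⁿ_)) j

paper-odd : ∀ s ss j → paper (s ∷ ss) (1 +ⁿ j *ⁿ 4) ≡ s × paper (s ∷ ss) (3 +ⁿ j *ⁿ 4) ≡ opposite s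
paper-odd s ss = go (paper ss) s
  where
  go : ∀ (g : ℕ → Sign) s j → interleave g (alternate s) (1 +ⁿ j *ⁿ 4) ≡ s × interleave g (alternate s) (3 +ⁿ j *ⁿ 4) ≡ opposite s
  go g s     zero    = refl , refl
  go g plus  (suc j) = go (g ∘ (2 +ⁿ_)) plus j
  go g minus (suc j) = go (g ∘ (2 +ⁿ_)) minus j

-- Lattice points, translations and parity

⊕-assoc : ∀ P Q R → (P ⊕ Q) ⊕ R ≡ P ⊕ (Q ⊕ R)
⊕-assoc (a , b) (c , d) (e , f) = cong₂ _,_ (ℤₚ.+-assoc a c e) (ℤₚ.+-assoc b d f)

⊕-comm : ∀ P Q → P ⊕ Q ≡ Q ⊕ P
⊕-comm (a , b) (c , d) = cong₂ _,_ (ℤₚ.+-comm a c) (ℤₚ.+-comm b d)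

origin : Point
origin = 0ℤ , 0ℤ

⊕-identityʳ : ∀ P → P ⊕ origin ≡ P
⊕-identityʳ (a , b) = cong₂ _,_ (ℤₚ.+-identityʳ a) (ℤₚ.+-identityʳ b)

⊕-identityˡ : ∀ P → origin ⊕ P ≡ P
⊕-identityˡ (a , b) = cong₂ _,_ (ℤₚ.+-identityˡ a) (ℤₚ.+-identityˡ b)

⊕-cancelˡ : ∀ P {Q R} → P ⊕ Q ≡ P ⊕ R → Q ≡ R
⊕-cancelˡ (a , b) eq with ,-injective eq
... | e , f = cong₂ _,_ (∙-cancelˡ a _ _ e) (∙-cancelˡ b _ _ f)

⊕-interchange : ∀ P Q R S → (P ⊕ Q) ⊕ (R ⊕ S) ≡ (P ⊕ R) ⊕ (Q ⊕ S)
⊕-interchange P Q R S = begin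
  (P ⊕ Q) ⊕ (R ⊕ S)   ≡⟨ ⊕-assoc P Q (R ⊕ S) ⟩
  P ⊕ (Q ⊕ (R ⊕ S))   ≡⟨ cong (P ⊕_) (sym (⊕-assoc Q R S)) ⟩
  P ⊕ ((Q ⊕ R) ⊕ S)   ≡⟨ cong (λ z → P ⊕ (z ⊕ S)) (⊕-comm Q R) ⟩
  P ⊕ ((R ⊕ Q) ⊕ S)   ≡⟨ cong (P ⊕_) (⊕-assoc R Q S) ⟩
  P ⊕ (R ⊕ (Q ⊕ S))   ≡⟨ sym (⊕-assoc P R (Q ⊕ S)) ⟩
  (P ⊕ R) ⊕ (Q ⊕ S)   ∎
  where open ≡-Reasoning

double : Point → Point
double P = P ⊕ P

_⊞_ : Point → Segment → Segment
v ⊞ (P , d) = v ⊕ P , d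

⊞-assoc : ∀ u v τ → (u ⊕ v) ⊞ τ ≡ u ⊞ (v ⊞ τ)
⊞-assoc u v (P , d) = cong (_, d) (⊕-assoc u v P)

support-⊞ : ∀ v τ → support (v ⊞ τ) ≡ translateE v (support τ)
support-⊞ v (P , east)  = refl
support-⊞ v (P , north) = refl
support-⊞ v (P , west)  = cong (_, horiz) (⊕-assoc v P (step west))
support-⊞ v (P , south) = cong (_, vert) (⊕-assoc v P (step south))

translateE-injective : ∀ v {e e'} → translateE v e ≡ translateE v e' → e ≡ e'
translateE-injective v {P , a} {P' , a'} eq with ,-injective eq
... | p , q = cong₂ _,_ (⊕-cancelˡ v p) q

odd : ℕ → Bool
odd zero    = false
odd (suc n) = not (odd n)

odd-+ : ∀ m n → odd (m +ⁿ n) ≡ odd m xor odd n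
odd-+ zero    n = refl
odd-+ (suc m) n = trans (cong not (odd-+ m n)) (not-distribˡ-xor (odd m) (odd n))

parity : ℤ → Bool
parity i = odd ∣ i ∣

xor-nots : ∀ a b → not a xor not b ≡ a xor b
xor-nots false false = refl
xor-nots false true  = refl
xor-nots true  false = refl
xor-nots true  true  = refl

parity-⊖ : ∀ m n → parity (m ⊖ n) ≡ odd m xor odd n
parity-⊖ zero    zero    = refl
parity-⊖ zero    (suc n) = refl
parity-⊖ (suc m) zero    = sym (xor-identityʳ _)
parity-⊖ (suc m) (suc n) = trans (cong parity (ℤₚ.[1+m]⊖[1+n]≡m⊖n m n))
  (trans (parity-⊖ m n) (sym (xor-nots (odd m) (odd n))))

parity-+ : ∀ i j → parity (i + j) ≡ parity i xor parity j
parity-+ (+ m)     (+ n)     = odd-+ m n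
parity-+ (+ m)     -[1+ n ]  = parity-⊖ m (suc n)
parity-+ -[1+ m ]  (+ n)     = trans (parity-⊖ n (suc m)) (xor-comm (odd n) (odd (suc m)))
parity-+ -[1+ m ]  -[1+ n ]  = trans (not-involutive _) (trans (odd-+ m n) (sym (xor-nots (odd m) (odd n))))

pointParity : Point → Bool
pointParity (x , y) = parity x xor parity y

xor-cancel : ∀ a b → a xor (a xor b) ≡ b
xor-cancel false b = refl
xor-cancel true  b = not-involutive b

xor-interchange : ∀ a b c d → (a xor b) xor (c xor d) ≡ (a xor c) xor (b xor d)
xor-interchange false false c     d = refl
xor-interchange false true  false d = refl
xor-interchange false true  true  d = refl
xor-interchange true  false false d = refl
xor-interchange true  false true  d = not-involutive d
xor-interchange true  true  false d = sym (not-involutive d)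
xor-interchange true  true  true  d = refl

pointParity-⊕ : ∀ P Q → pointParity (P ⊕ Q) ≡ pointParity P xor pointParity Q
pointParity-⊕ (a , b) (c , d) = trans (cong₂ _xor_ (parity-+ a c) (parity-+ b d))
  (xor-interchange (parity a) (parity c) (parity b) (parity d))

vertical : Dir → Bool
vertical east  = false
vertical north = true
vertical west  = false
vertical south = true

-- Constant along a walk, so that the supports of a walk determine how they are oriented.
colour : Segment → Bool
colour (P , d) = pointParity P xor vertical d

colour-⊞ : ∀ v τ → colour (v ⊞ τ) ≡ pointParity v xor colour τ
colour-⊞ v (P , d) = trans (cong (_xor vertical d) (pointParity-⊕ v P))
  (xor-assoc (pointParity v) (pointParity P) (vertical d))

parity-step : ∀ Q d b → pointParity (Q ⊕ step d) xor b ≢ pointParity Q xor b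
parity-step Q d b eq = clash (pointParity Q) b
  (trans (cong (_xor b) (trans (cong (pointParity Q xor_) (sym (odd-step d))) (sym (pointParity-⊕ Q (step d))))) eq)
  where
  odd-step : ∀ d → pointParity (step d) ≡ true
  odd-step east  = refl
  odd-step north = refl
  odd-step west  = refl
  odd-step south = refl
  clash : ∀ q b → (q xor true) xor b ≢ q xor b
  clash false false ()
  clash false true  ()
  clash true  false ()
  clash true  true  ()

-- The two orientations of an edge have the same axis but initial points of opposite parity, hence
-- different colours.
colour-support : ∀ σ τ → colour σ ≡ colour τ → support σ ≡ support τ → σ ≡ τ
colour-support (P , east)  (Q , east)  c refl = refl
colour-support (P , north) (Q , north) c refl = refl
colour-support (P , west)  (Q , west)  c eq = cong (_, west) (⊕-cancelˡ (step west)
  (trans (⊕-comm _ P) (trans (proj₁ (,-injective eq)) (⊕-comm Q _))))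
colour-support (P , south) (Q , south) c eq = cong (_, south) (⊕-cancelˡ (step south)
  (trans (⊕-comm _ P) (trans (proj₁ (,-injective eq)) (⊕-comm Q _))))
colour-support (P , east)  (Q , west)  c refl = contradiction c (parity-step Q west false)
colour-support (P , west)  (Q , east)  c refl = contradiction (sym c) (parity-step P west false)
colour-support (P , north) (Q , south) c refl = contradiction c (parity-step Q south true)
colour-support (P , south) (Q , north) c refl = contradiction (sym c) (parity-step P south true)

-- Walks

rotate : Sign → Dir → Dir
rotate plus  = rotL
rotate minus = rotR

next : Sign → Segment → Segment
next ε (P , d) = P ⊕ step d , rotate ε d

-- The turn into segment `suc k` is `f (suc k)`, in accordance with the numbering of turns from 1.
walk : (ℕ → Sign) → Segment → ℕ → Segment
walk f σ zero    = σ
walk f σ (suc k) = next (f (suc k)) (walk f σ k)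

-- A step flips the parity of the initial point and a turn flips the axis; the two changes cancel.
colour-next : ∀ ε τ → colour (next ε τ) ≡ colour τ
colour-next ε (P , d) = trans (cong (_xor vertical (rotate ε d)) (pointParity-⊕ P (step d)))
  (trans (xor-assoc (pointParity P) _ _) (cong (pointParity P xor_) (turn-colour ε d)))
  where
  turn-colour : ∀ ε d → pointParity (step d) xor vertical (rotate ε d) ≡ vertical d
  turn-colour plus  east  = refl
  turn-colour plus  north = refl
  turn-colour plus  west  = refl
  turn-colour plus  south = refl
  turn-colour minus east  = refl
  turn-colour minus north = refl
  turn-colour minus west  = refl
  turn-colour minus south = refl

colour-walk : ∀ f σ k → colour (walk f σ k) ≡ colour σ
colour-walk f σ zero    = refl
colour-walk f σ (suc k) = trans (colour-next (f (suc k)) (walk f σ k)) (colour-walk f σ k)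

-- Unfolding twice

-- The middle turn of a block of four segments alternates along the coarse walk, and so does the axis of
-- the coarse segment; hence it can be read off the direction, β being its value on horizontal segments.
middle : Sign → Dir → Sign
middle β east  = β
middle β north = opposite β
middle β west  = β
middle β south = opposite β

-- The turns inside a block are `α`, the middle one and `opposite α`. This is the initial direction
-- for which the four steps add up to twice the step in direction `d`.
first : Sign → Sign → Dir → Dir
first α β d = go α (middle β d)
  where
  go : Sign → Sign → Dir
  go plus  plus  = rotR d
  go plus  minus = d
  go minus plus  = d
  go minus minus = rotL d

turns : Sign → Sign → Dir → Fin 4 → Dir
turns α β d 0F = first α β d
turns α β d 1F = rotate α (first α β d)
turns α β d 2F = rotate (middle β d) (rotate α (first α β d))
turns α β d 3F = rotate (opposite α) (rotate (middle β d) (rotate α (first α β d)))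

offset : Sign → Sign → Dir → Fin 4 → Point
offset α β d 0F = origin
offset α β d 1F = origin ⊕ step (turns α β d 0F)
offset α β d 2F = (origin ⊕ step (turns α β d 0F)) ⊕ step (turns α β d 1F)
offset α β d 3F = ((origin ⊕ step (turns α β d 0F)) ⊕ step (turns α β d 1F)) ⊕ step (turns α β d 2F)

unfold : Sign → Sign → Fin 4 → Segment → Segment
unfold α β i (P , d) = double P ⊕ offset α β d i , turns α β d i

unfold-⊞ : ∀ α β i v τ → unfold α β i (v ⊞ τ) ≡ double v ⊞ unfold α β i τ
unfold-⊞ α β i v (P , d) = cong (_, turns α β d i)
  (trans (cong (_⊕ offset α β d i) (⊕-interchange v P v P)) (⊕-assoc (double v) (double P) _))

signs : ∀ {P : Sign → Set} → P plus → P minus → ∀ s → P s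
signs p m plus  = p
signs p m minus = m

dirs : ∀ {P : Dir → Set} → P east → P north → P west → P south → ∀ d → P d
dirs e n w s east  = e
dirs e n w s north = n
dirs e n w s west  = w
dirs e n w s south = s

unfold-end : ∀ α β d → offset α β d 3F ⊕ step (turns α β d 3F) ≡ double (step d)
unfold-end plus  plus  = dirs refl refl refl refl
unfold-end plus  minus = dirs refl refl refl refl
unfold-end minus plus  = dirs refl refl refl refl
unfold-end minus minus = dirs refl refl refl refl

-- Chains consecutive blocks: turning by the coarse sign after the last fine segment lands on the
-- direction prescribed for the next block.
unfold-turn : ∀ α β ε d → rotate ε (turns α β d 3F) ≡ first α β (rotate ε d)
unfold-turn plus  plus  plus  = dirs refl refl refl refl
unfold-turn plus  plus  minus = dirs refl refl refl refl
unfold-turn plus  minus plus  = dirs refl refl refl refl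
unfold-turn plus  minus minus = dirs refl refl refl refl
unfold-turn minus plus  plus  = dirs refl refl refl refl
unfold-turn minus plus  minus = dirs refl refl refl refl
unfold-turn minus minus plus  = dirs refl refl refl refl
unfold-turn minus minus minus = dirs refl refl refl refl

middle-rotate : ∀ β ε d → middle β (rotate ε d) ≡ opposite (middle β d)
middle-rotate plus  plus  = dirs refl refl refl refl
middle-rotate plus  minus = dirs refl refl refl refl
middle-rotate minus plus  = dirs refl refl refl refl
middle-rotate minus minus = dirs refl refl refl refl

-- Solves for the coarse direction whose block begins in direction `d` when its first two turns are
-- `s` and `t`.
foldedDir : Sign → Sign → Dir → Dir
foldedDir plus  plus  d = rotL d
foldedDir plus  minus d = d
foldedDir minus plus  d = d
foldedDir minus minus d = rotR d

-- For a fixed direction `middle` is an involution in the sign, so applying it to `t` gives the sign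
-- whose middle turn in that direction is `t`.
foldedSign : Sign → Sign → Dir → Sign
foldedSign s t d = middle t (foldedDir s t d)

foldedDir-first : ∀ s t d → first s (foldedSign s t d) (foldedDir s t d) ≡ d
foldedDir-first plus  plus  = dirs refl refl refl refl
foldedDir-first plus  minus = dirs refl refl refl refl
foldedDir-first minus plus  = dirs refl refl refl refl
foldedDir-first minus minus = dirs refl refl refl refl

foldedSign-middle : ∀ s t d → t ≡ middle (foldedSign s t d) (foldedDir s t d)
foldedSign-middle plus  plus  = dirs refl refl refl refl
foldedSign-middle plus  minus = dirs refl refl refl refl
foldedSign-middle minus plus  = dirs refl refl refl refl
foldedSign-middle minus minus = dirs refl refl refl refl

module Unfold (s t : Sign) (ss : List Sign) (p : Point) (d : Dir) where

  β : Sign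
  β = foldedSign s t d

  fine coarse : ℕ → Segment
  fine   = walk (paper (s ∷ t ∷ ss)) (p , d)
  coarse = walk (paper ss) (origin , foldedDir s t d)

  private
    advance : ∀ {ε ε' k} i j → let P , D = coarse j in ε ≡ ε' → fine k ≡ p ⊞ unfold s β i (P , D) →
              next ε (fine k) ≡ p ⊞ (double P ⊕ (offset s β D i ⊕ step (turns s β D i)) , rotate ε' (turns s β D i))
    advance i j refl eq rewrite eq = cong (_, _)
      (trans (⊕-assoc p _ _) (cong (p ⊕_) (⊕-assoc (double (proj₁ (coarse j))) _ _)))

    -- The induction carries a second component because the middle turn is known by its position in
    -- the sequence, while `unfold` reads it off the coarse direction.
    block : ∀ j → (fine (j *ⁿ 4) ≡ p ⊞ unfold s β 0F (coarse j)) ×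
                  (alternate t j ≡ middle β (proj₂ (coarse j)))
    fine-1 : ∀ j → fine (1 +ⁿ j *ⁿ 4) ≡ p ⊞ unfold s β 1F (coarse j)
    fine-2 : ∀ j → fine (2 +ⁿ j *ⁿ 4) ≡ p ⊞ unfold s β 2F (coarse j)
    fine-3 : ∀ j → fine (3 +ⁿ j *ⁿ 4) ≡ p ⊞ unfold s β 3F (coarse j)

    fine-1 j = advance {k = j *ⁿ 4} 0F j (proj₁ (paper-odd s (t ∷ ss) j)) (proj₁ (block j))
    fine-2 j = advance {k = 1 +ⁿ j *ⁿ 4} 1F j (trans (paper-2 s t ss j) (proj₂ (block j))) (fine-1 j)
    fine-3 j = advance {k = 2 +ⁿ j *ⁿ 4} 2F j (proj₂ (paper-odd s (t ∷ ss) j)) (fine-2 j)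

    block zero = cong₂ _,_ (sym (⊕-identityʳ p)) (sym (foldedDir-first s t d)) , foldedSign-middle s t d
    block (suc j) = trans (advance {k = 3 +ⁿ j *ⁿ 4} 3F j (paper-0 s t ss (suc j)) (fine-3 j)) (cong₂ _,_ (cong (p ⊕_) position) (unfold-turn s β ε D)) ,
      trans (alternate-opposite t j) (trans (cong opposite (proj₂ (block j))) (sym (middle-rotate β ε D)))
      where
      P = proj₁ (coarse j)
      D = proj₂ (coarse j)
      ε = paper ss (suc j)
      position : double P ⊕ (offset s β D 3F ⊕ step (turns s β D 3F)) ≡ double (P ⊕ step D) ⊕ origin
      position = trans (cong (double P ⊕_) (unfold-end s β D))
        (trans (sym (⊕-interchange P (step D) P (step D))) (sym (⊕-identityʳ _)))

  fine≡unfold : ∀ i j → fine (toℕ i +ⁿ j *ⁿ 4) ≡ p ⊞ unfold s β i (coarse j)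
  fine≡unfold 0F j = proj₁ (block j)
  fine≡unfold 1F   = fine-1
  fine≡unfold 2F   = fine-2
  fine≡unfold 3F   = fine-3

-- Squares of lattice points and windows of indices

InSquare : Point → ℕ → Point → Set
InSquare c w P = Σ ℕ λ x → Σ ℕ λ y → x ≤ⁿ w × y ≤ⁿ w × P ≡ c ⊕ (+ x , + y)

Near : ℕ → ℕ → ℕ → Set
Near L k x = (k ≤ⁿ x +ⁿ L) × (x ≤ⁿ k +ⁿ L)

-- With equal `i` and `i'` this says that a window of radius `L` repeats no segment; with different
-- ones, that two windows share none.
Separated : ∀ {n} → ℕ → (ℕ → Segment) → (Fin n → ℕ) → Set
Separated L Q k = ∀ i i' x x' → Near L (k i) x → Near L (k i') x' → Q x ≡ Q x' → (i ≡ i') × (x ≡ x')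

-- Rounding to the coarser lattice

Small : Point → Set
Small (a , b) = T (∣ a ∣ ≤ᵇ 1) × T (∣ b ∣ ≤ᵇ 1)

double-cancel-≤ : ∀ {e w} → e +ⁿ e ≤ⁿ suc (w +ⁿ w) → e ≤ⁿ w
double-cancel-≤ {e} {w} le with e ℕₚ.≤? w
... | yes p = p
... | no ¬p = contradiction
  (ℕₚ.≤-trans (ℕₚ.≤-trans (ℕₚ.≤-reflexive (cong suc (sym (ℕₚ.+-suc w w)))) (ℕₚ.+-mono-≤ w<e w<e)) le)
  (ℕₚ.<-irrefl refl)
  where w<e = ℕₚ.≰⇒> ¬p

-- The even number `E + E` lies between -1 and 2w + 1, so `E` lies between 0 and `w`.
round-difference : ∀ E δ {m w} → T (∣ δ ∣ ≤ᵇ 1) → (E + E) + δ ≡ + m → m ≤ⁿ w +ⁿ w →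
                   Σ ℕ λ e → e ≤ⁿ w × E ≡ + e
round-difference (+ e) (+ 0) {m} _ eq le =
  e , double-cancel-≤ (ℕₚ.m≤n⇒m≤1+n (ℕₚ.≤-trans (ℕₚ.≤-reflexive (trans (sym (ℕₚ.+-identityʳ _)) (ℤₚ.+-injective eq))) le)) , refl
round-difference (+ e) (+ 1) {m} _ eq le =
  e , double-cancel-≤ (ℕₚ.m≤n⇒m≤1+n (ℕₚ.≤-trans (ℕₚ.m≤m+n (e +ⁿ e) 1) (ℕₚ.≤-trans (ℕₚ.≤-reflexive (ℤₚ.+-injective eq)) le))) , refl
round-difference (+ e) -[1+ 0 ] {m} _ eq le = e , double-cancel-≤ (ℕₚ.≤-trans (bound (e +ⁿ e) eq) (s≤s le)) , refl
  where
  bound : ∀ k → k ⊖ 1 ≡ + m → k ≤ⁿ suc m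
  bound zero    ()
  bound (suc k) eq = s≤s (ℕₚ.≤-reflexive (ℤₚ.+-injective eq))
round-difference -[1+ e ] (+ 0) _ ()
round-difference -[1+ e ] (+ 1) _ ()
round-difference -[1+ e ] -[1+ 0 ] _ ()

halve : ∀ z → Σ ℤ λ h → Σ ℕ λ ρ → ρ ≤ⁿ 1 × z ≡ (h + h) + + ρ
halve z = z /ℕ 2 , z %ℕ 2 , ℕₚ.≤-pred (n%ℕd<d z 2) ,
  trans (a≡a%ℕn+[a/ℕn]*n z 2) (rearrange (+ (z %ℕ 2)) (z /ℕ 2))
  where
  rearrange : ∀ r h → r + h * + 2 ≡ (h + h) + r
  rearrange = solve-∀

-- Here `h` is half of `a - p`, rounded down. It depends on neither `X` nor `δ`, so one corner
-- serves all points; the remainder, at most 1, is absorbed by the strict bound on `n`.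
round : ∀ p a → Σ ℤ λ h → ∀ X δ {n w} → T (∣ δ ∣ ≤ᵇ 1) →
  p + ((X + X) + δ) ≡ a + + n → n < w +ⁿ w → Σ ℕ λ e → e ≤ⁿ w × X ≡ h + + e
round p a with halve (a - p)
... | h , ρ , ρ≤1 , eq = h , λ X δ {n} {w} small pos n<2w →
  let e , e≤w , E≡e = round-difference (X - h) δ small (shifted X δ n pos) (ℕₚ.≤-trans (ℕₚ.+-monoˡ-≤ n ρ≤1) n<2w)
  in e , e≤w , trans (undo X h) (cong (λ z → h + z) E≡e)
  where
  undo : ∀ X h → X ≡ h + (X - h)
  undo = solve-∀
  expand : ∀ p X h δ → ((X - h) + (X - h)) + δ ≡ (p + ((X + X) + δ)) - (p + (h + h))
  expand = solve-∀
  collapse : ∀ a n p h → (a + n) - (p + (h + h)) ≡ ((a - p) - (h + h)) + n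
  collapse = solve-∀
  residue : ∀ h r → ((h + h) + r) - (h + h) ≡ r
  residue = solve-∀
  shifted : ∀ X δ n → p + ((X + X) + δ) ≡ a + + n → ((X - h) + (X - h)) + δ ≡ + (ρ +ⁿ n)
  shifted X δ n pos = begin
    ((X - h) + (X - h)) + δ              ≡⟨ expand p X h δ ⟩
    (p + ((X + X) + δ)) - (p + (h + h))  ≡⟨ cong (_- (p + (h + h))) pos ⟩
    (a + + n) - (p + (h + h))            ≡⟨ collapse a (+ n) p h ⟩
    ((a - p) - (h + h)) + + n            ≡⟨ cong (λ z → (z - (h + h)) + + n) eq ⟩
    (((h + h) + + ρ) - (h + h)) + + n    ≡⟨ cong (_+ + n) (residue h (+ ρ)) ⟩
    + ρ + + n                            ∎
    where open ≡-Reasoning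

coarse-square : ∀ p c → Σ Point λ c' → ∀ {w w'} P v → Small v → w' < w +ⁿ w →
  InSquare c w' (p ⊕ (double P ⊕ v)) → InSquare c' w P
coarse-square (p , q) (a , b) = (proj₁ (round p a) , proj₁ (round q b)) , inside
  where
  inside : ∀ {w w'} P v → Small v → w' < w +ⁿ w →
    InSquare (a , b) w' ((p , q) ⊕ (double P ⊕ v)) → InSquare (proj₁ (round p a) , proj₁ (round q b)) w P
  inside (X , Y) (δ , δ') (sx , sy) w'<2w (x , y , x≤ , y≤ , eq) =
    let e , e≤ , eqx = proj₂ (round p a) X δ sx (cong proj₁ eq) (ℕₚ.≤-<-trans x≤ w'<2w)
        f , f≤ , eqy = proj₂ (round q b) Y δ' sy (cong proj₂ eq) (ℕₚ.≤-<-trans y≤ w'<2w)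
    in e , f , e≤ , f≤ , cong₂ _,_ eqx eqy

-- The first two steps of a block are perpendicular, so its first three vertices stay within 1 of
-- the doubled initial point in each coordinate. The fourth is one step before the doubled terminal
-- point.
close-offset : ∀ α β i d → Small (offset α β d i) ⊎
               Σ Point λ v → Small v × offset α β d i ≡ double (step d) ⊕ v
close-offset α β 0F = λ _ → inj₁ _
close-offset plus  plus  1F = dirs (inj₁ _) (inj₁ _) (inj₁ _) (inj₁ _)
close-offset plus  minus 1F = dirs (inj₁ _) (inj₁ _) (inj₁ _) (inj₁ _)
close-offset minus plus  1F = dirs (inj₁ _) (inj₁ _) (inj₁ _) (inj₁ _)
close-offset minus minus 1F = dirs (inj₁ _) (inj₁ _) (inj₁ _) (inj₁ _)
close-offset plus  plus  2F = dirs (inj₁ _) (inj₁ _) (inj₁ _) (inj₁ _)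
close-offset plus  minus 2F = dirs (inj₁ _) (inj₁ _) (inj₁ _) (inj₁ _)
close-offset minus plus  2F = dirs (inj₁ _) (inj₁ _) (inj₁ _) (inj₁ _)
close-offset minus minus 2F = dirs (inj₁ _) (inj₁ _) (inj₁ _) (inj₁ _)
close-offset α β 3F d = inj₂ (step (opp t) , small-step (opp t) , back (offset α β d 3F) (unfold-end α β d))
  where
  t = turns α β d 3F
  opp : Dir → Dir
  opp = rotL ∘ rotL
  small-step : ∀ d → Small (step d)
  small-step = dirs _ _ _ _
  step-opp : ∀ d → step d ⊕ step (opp d) ≡ origin
  step-opp = dirs refl refl refl refl
  back : ∀ o {q} → o ⊕ step t ≡ q → o ≡ q ⊕ step (opp t)
  back o refl = sym (trans (⊕-assoc o (step t) (step (opp t))) (trans (cong (o ⊕_) (step-opp t)) (⊕-identityʳ o)))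

module _ (s t : Sign) (ss : List Sign) (p : Point) (d : Dir) where
  open Unfold s t ss p d

  coarse-index : ∀ k → Σ ℕ λ j → Σ Point λ v → Near 4 k (j *ⁿ 4) × Small v ×
                 initial (fine k) ≡ p ⊕ (double (initial (coarse j)) ⊕ v)
  coarse-index k with k divMod 4
  ... | result q r refl with close-offset s β r (proj₂ (coarse q))
  ...   | inj₁ small = q , offset s β (proj₂ (coarse q)) r ,
    (subst (_≤ⁿ q *ⁿ 4 +ⁿ 4) (ℕₚ.+-comm (q *ⁿ 4) (toℕ r)) (ℕₚ.+-monoʳ-≤ (q *ⁿ 4) (ℕₚ.<⇒≤ (Finₚ.toℕ<n r))) ,
     ℕₚ.≤-trans (ℕₚ.m≤n+m (q *ⁿ 4) (toℕ r)) (ℕₚ.m≤m+n _ 4)) ,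
    small , cong proj₁ (fine≡unfold r q)
  ...   | inj₂ (v , small , eq) = suc q , v ,
    (ℕₚ.≤-trans (ℕₚ.+-monoˡ-≤ (q *ⁿ 4) (ℕₚ.<⇒≤ (Finₚ.toℕ<n r))) (ℕₚ.m≤m+n _ 4) ,
     ℕₚ.≤-trans (ℕₚ.≤-reflexive (ℕₚ.+-comm 4 (q *ⁿ 4))) (ℕₚ.+-monoˡ-≤ 4 (ℕₚ.m≤n+m (q *ⁿ 4) (toℕ r)))) ,
    small , trans (cong proj₁ (fine≡unfold r q)) (cong (p ⊕_)
      (trans (cong (double P ⊕_) eq) (trans (sym (⊕-assoc (double P) (double (step D)) v))
        (cong (_⊕ v) (sym (⊕-interchange P (step D) P (step D)))))))
    where
    P = proj₁ (coarse q)
    D = proj₂ (coarse q)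

_≟Dir_ : DecidableEquality Dir
east  ≟Dir east  = yes refl
east  ≟Dir north = no λ ()
east  ≟Dir west  = no λ ()
east  ≟Dir south = no λ ()
north ≟Dir east  = no λ ()
north ≟Dir north = yes refl
north ≟Dir west  = no λ ()
north ≟Dir south = no λ ()
west  ≟Dir east  = no λ ()
west  ≟Dir north = no λ ()
west  ≟Dir west  = yes refl
west  ≟Dir south = no λ ()
south ≟Dir east  = no λ ()
south ≟Dir north = no λ ()
south ≟Dir west  = no λ ()
south ≟Dir south = yes refl

_≟Point_ : DecidableEquality Point
_≟Point_ = ≡-dec ℤ._≟_ ℤ._≟_

_≟Segment_ : DecidableEquality Segment
_≟Segment_ = ≡-dec _≟Point_ _≟Dir_

-- Leaving a 3 × 3 block

cell : Fin 3 → Fin 3 → Point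
cell x y = + toℕ x , + toℕ y

InBlock : Point → Point → Set
InBlock c P = Σ (Fin 3) λ x → Σ (Fin 3) λ y → P ≡ c ⊕ cell x y

inBlock? : ∀ c P → Dec (InBlock c P)
inBlock? c P = Finₚ.any? λ x → Finₚ.any? λ y → P ≟Point (c ⊕ cell x y)

square⇒block : ∀ c {P} → InSquare c 2 P → InBlock c P
square⇒block c (x , y , x≤2 , y≤2 , eq) = Fin.fromℕ< (s≤s x≤2) , Fin.fromℕ< (s≤s y≤2) ,
  trans eq (cong (c ⊕_) (cong₂ (λ m n → + m , + n) (sym (Finₚ.toℕ-fromℕ< _)) (sym (Finₚ.toℕ-fromℕ< _))))

-- Of the 12 outward edges at the boundary, a colour allows half: for `false`, horizontal segments
-- start at even points and vertical ones at odd points; for `true` the reverse.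
exit : Bool → Fin 6 → Segment
exit false 0F = cell 0F 0F , west
exit false 1F = cell 0F 2F , west
exit false 2F = cell 2F 0F , east
exit false 3F = cell 2F 2F , east
exit false 4F = cell 1F 0F , south
exit false 5F = cell 1F 2F , north
exit true  0F = cell 0F 0F , south
exit true  1F = cell 2F 0F , south
exit true  2F = cell 0F 2F , north
exit true  3F = cell 2F 2F , north
exit true  4F = cell 0F 1F , west
exit true  5F = cell 2F 1F , east

Exits : Bool → Dir → Set
Exits b d = ∀ x y → colour (cell x y , d) ≢ b ⊎
  InBlock origin (cell x y ⊕ step d) ⊎ Σ (Fin 6) λ i → (cell x y , d) ≡ exit b i

exits? : ∀ b d → Dec (Exits b d)
exits? b d = Finₚ.all? λ x → Finₚ.all? λ y → ¬? (colour (cell x y , d) Boolₚ.≟ b) ⊎-dec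
  (inBlock? origin (cell x y ⊕ step d) ⊎-dec Finₚ.any? λ i → (cell x y , d) ≟Segment exit b i)

exits : ∀ b d → Exits b d
exits false = dirs (toWitness {a? = exits? false east} _) (toWitness {a? = exits? false north} _) (toWitness {a? = exits? false west} _) (toWitness {a? = exits? false south} _)
exits true  = dirs (toWitness {a? = exits? true east} _) (toWitness {a? = exits? true north} _) (toWitness {a? = exits? true west} _) (toWitness {a? = exits? true south} _)

dirIndex : Dir → Fin 4
dirIndex east  = 0F
dirIndex north = 1F
dirIndex west  = 2F
dirIndex south = 3F

dirIndex-injective : ∀ d d' → dirIndex d ≡ dirIndex d' → d ≡ d'
dirIndex-injective east  east  _ = refl
dirIndex-injective north north _ = refl
dirIndex-injective west  west  _ = refl
dirIndex-injective south south _ = refl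

module _ (f : ℕ → Sign) (σ : Segment) (c : Point) where

  private
    Q : ℕ → Segment
    Q = walk f σ

    b : Bool
    b = pointParity c xor colour σ

  leave-or-stay : ∀ k N → InBlock c (initial (Q k)) →
    (Σ ℕ λ m → m < N × InBlock c (initial (Q (m +ⁿ k))) × ¬ InBlock c (initial (Q (suc m +ⁿ k)))) ⊎
    (∀ m → m ≤ⁿ N → InBlock c (initial (Q (m +ⁿ k))))
  leave-or-stay k zero    start = inj₂ λ { zero _ → start }
  leave-or-stay k (suc N) start with leave-or-stay k N start
  ... | inj₁ (m , m<N , i , o) = inj₁ (m , ℕₚ.m≤n⇒m≤1+n m<N , i , o)
  ... | inj₂ stay with inBlock? c (initial (Q (suc N +ⁿ k)))
  ...   | no out = inj₁ (N , ℕₚ.≤-refl , stay N ℕₚ.≤-refl , out)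
  ...   | yes inside = inj₂ λ m m≤ → extend m (ℕₚ.m≤n⇒m<n∨m≡n m≤)
    where
    extend : ∀ m → m < suc N ⊎ m ≡ suc N → InBlock c (initial (Q (m +ⁿ k)))
    extend m (inj₁ (s≤s m≤N)) = stay m m≤N
    extend m (inj₂ refl)      = inside

  -- Nine points and four directions leave 36 possible segments starting in the block.
  code : ∀ k → InBlock c (initial (Q k)) → Fin 36
  code k (x , y , _) = combine (combine x y) (dirIndex (proj₂ (Q k)))

  code-injective : ∀ k l p q → code k p ≡ code l q → Q k ≡ Q l
  code-injective k l (x , y , eq) (x' , y' , eq') same
    with Finₚ.combine-injective (combine x y) _ (combine x' y') _ same
  ... | e , e' with Finₚ.combine-injective x y x' y' e
  ...   | refl , refl = cong₂ _,_ (trans eq (sym eq')) (dirIndex-injective _ _ e')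

  exit-segment : ∀ k → InBlock c (initial (Q k)) → ¬ InBlock c (initial (Q (suc k))) →
                 Σ (Fin 6) λ i → Q k ≡ c ⊞ exit b i
  exit-segment k (x , y , eq) out with exits b (proj₂ (Q k)) x y
  ... | inj₁ wrong = contradiction colour-local wrong
    where
    colour-local : colour (cell x y , proj₂ (Q k)) ≡ b
    colour-local = trans (sym (xor-cancel (pointParity c) _)) (cong (pointParity c xor_)
      (trans (sym (colour-⊞ c (cell x y , proj₂ (Q k))))
        (trans (cong (λ P → colour (P , proj₂ (Q k))) (sym eq)) (colour-walk f σ k))))
  ... | inj₂ (inj₁ (x' , y' , eq')) = contradiction
    (x' , y' , trans (cong (_⊕ step (proj₂ (Q k))) eq)
      (trans (⊕-assoc c (cell x y) _) (cong (c ⊕_) (trans eq' (⊕-identityˡ _))))) out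
  ... | inj₂ (inj₂ (i , e)) = i , trans (cong (_, proj₂ (Q k)) eq) (cong (c ⊞_) e)

  -- A window without repetition has to leave the block, and does so along one of six segments. Two
  -- of seven windows then share an exit segment.
  seven-exits : (k : Fin 7 → ℕ) → (∀ i → InBlock c (initial (Q (k i)))) → Separated 36 Q k → ⊥
  seven-exits k inside separated =
    let i , j , i<j , same = Finₚ.pigeonhole ℕₚ.≤-refl (λ i → proj₁ (exit-index i))
        m , m≤ , eq  = proj₂ (exit-index i)
        n , n≤ , eq' = proj₂ (exit-index j)
    in Finₚ.<⇒≢ i<j (proj₁ (separated i j (m +ⁿ k i) (n +ⁿ k j) (near i m≤) (near j n≤)
         (trans eq (trans (cong (λ z → c ⊞ exit b z) same) (sym eq')))))
    where
    near : ∀ i {m} → m ≤ⁿ 36 → Near 36 (k i) (m +ⁿ k i)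
    near i {m} m≤ = ℕₚ.≤-trans (ℕₚ.m≤n+m (k i) m) (ℕₚ.m≤m+n _ 36) ,
      ℕₚ.≤-trans (ℕₚ.≤-reflexive (ℕₚ.+-comm m (k i))) (ℕₚ.+-monoʳ-≤ (k i) m≤)
    exit-index : ∀ i → Σ (Fin 6) λ e → Σ ℕ λ m → m ≤ⁿ 36 × Q (m +ⁿ k i) ≡ c ⊞ exit b e
    exit-index i with leave-or-stay (k i) 36 (inside i)
    ... | inj₁ (m , m< , stays , out) =
      let e , eq = exit-segment (m +ⁿ k i) stays out in e , m , ℕₚ.<⇒≤ m< , eq
    -- Staying gives 37 consecutive segments with 36 codes, so one of them would recur inside the
    -- window.
    ... | inj₂ stay =
      let stays : (a : Fin 37) → InBlock c (initial (Q (toℕ a +ⁿ k i)))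
          stays a = stay (toℕ a) (Finₚ.toℕ≤pred[n] a)
          a , a' , a<a' , same = Finₚ.pigeonhole ℕₚ.≤-refl (λ a → code (toℕ a +ⁿ k i) (stays a))
          _ , eq = separated i i _ _ (near i (Finₚ.toℕ≤pred[n] a)) (near i (Finₚ.toℕ≤pred[n] a'))
                     (code-injective _ _ (stays a) (stays a') same)
      in contradiction (ℕₚ.+-cancelʳ-≡ (k i) _ _ eq) (ℕₚ.<⇒≢ a<a')

-- Seven close windows

radius : ℕ → ℕ
radius zero    = 36
radius (suc M) = radius M *ⁿ 4 +ⁿ 4

-- Each coarsening consumes two folds and roughly halves the square, down to a 3 × 3 block. Since k
-- and 4j differ by at most 4, indices within r of the coarse index j have quadruples within 4r + 4
-- of k, which explains the recursion of `radius`.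
seven-close-indices : ∀ M ss σ c (k : Fin 7 → ℕ) → M *ⁿ 2 ≤ⁿ length ss →
  (∀ i → InSquare c (suc (2 ^ M)) (initial (walk (paper ss) σ (k i)))) →
  Separated (radius M) (walk (paper ss) σ) k → ⊥
seven-close-indices zero ss σ c k _ inside separated =
  seven-exits (paper ss) σ c k (λ i → square⇒block c (inside i)) separated
seven-close-indices (suc M) (s ∷ t ∷ ss) (p , d) c k (s≤s (s≤s deep)) inside separated =
  let c' , coarsen = coarse-square p c
  in seven-close-indices M ss _ c' (λ i → j i) deep
       (λ i → let _ , v , _ , small , eq = coarse-index s t ss p d (k i)
              in coarsen (initial (coarse (j i))) v small width (subst (InSquare c _) eq (inside i)))
       -- Equal coarse segments unfold to equal first fine segments, at the indices 4x and 4x', so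
       -- separation passes to the coarse walk.
       λ i i' x x' n n' eq →
         let same , x≡x' = separated i i' (x *ⁿ 4) (x' *ⁿ 4) (near i n) (near i' n')
                             (trans (fine≡unfold 0F x) (trans (cong (λ τ → p ⊞ unfold s β 0F τ) eq) (sym (fine≡unfold 0F x'))))
         in same , ℕₚ.*-cancelʳ-≡ x x' 4 x≡x'
  where
  open Unfold s t ss p d
  j : Fin 7 → ℕ
  j i = proj₁ (coarse-index s t ss p d (k i))
  -- 2^(M+1) + 1 is the largest side that `coarse-square` rounds into side 2^M + 1.
  width : suc (2 ^ suc M) < suc (2 ^ M) +ⁿ suc (2 ^ M)
  width = ℕₚ.≤-reflexive (cong suc (trans (cong suc (cong (2 ^ M +ⁿ_) (ℕₚ.+-identityʳ (2 ^ M)))) (sym (ℕₚ.+-suc (2 ^ M) (2 ^ M)))))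
  near : ∀ i {x} → Near (radius M) (j i) x → Near (radius (suc M)) (k i) (x *ⁿ 4)
  near i {x} (lo , hi) =
    let _ , _ , (lo' , hi') , _ = coarse-index s t ss p d (k i)
    in ℕₚ.≤-trans lo' (ℕₚ.≤-trans (ℕₚ.+-monoˡ-≤ 4 (ℕₚ.*-monoˡ-≤ 4 lo)) (ℕₚ.≤-reflexive (spread x (radius M)))) ,
       ℕₚ.≤-trans (ℕₚ.*-monoˡ-≤ 4 hi) (ℕₚ.≤-trans (ℕₚ.≤-reflexive (ℕₚ.*-distribʳ-+ 4 (j i) (radius M)))
         (ℕₚ.≤-trans (ℕₚ.+-monoˡ-≤ (radius M *ⁿ 4) hi') (ℕₚ.≤-reflexive (swap (k i) (radius M *ⁿ 4)))))
    where
    spread : ∀ x r → (x +ⁿ r) *ⁿ 4 +ⁿ 4 ≡ x *ⁿ 4 +ⁿ (r *ⁿ 4 +ⁿ 4)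
    spread = ℕSolver.solve-∀
    swap : ∀ k r → k +ⁿ 4 +ⁿ r ≡ k +ⁿ (r +ⁿ 4)
    swap = ℕSolver.solve-∀

-- Edges traversed by a walk

Visits : (ℕ → Segment) → ℕ → ℕ → Segment → Set
Visits Q lo hi τ = Σ ℕ λ k → lo ≤ⁿ k × k < hi × Q k ≡ τ

Covers : (ℕ → Segment) → ℕ → ℕ → Edge → Set
Covers Q lo hi e = Σ ℕ λ k → lo ≤ⁿ k × k < hi × support (Q k) ≡ e

-- The index range is recorded because a walk follows a given curve only along a finite window.
Full : (ℕ → Segment) → ℕ → ℕ → Point → ℕ → Set
Full Q lo hi c w =
  (∀ x y → x < w → y ≤ⁿ w → Covers Q lo hi (c ⊕ (+ x , + y) , horiz)) ×
  (∀ x y → x ≤ⁿ w → y < w → Covers Q lo hi (c ⊕ (+ x , + y) , vert))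

index-bounds : ∀ {lo hi j} (i : Fin 4) → lo ≤ⁿ j → j < hi →
               lo *ⁿ 4 ≤ⁿ toℕ i +ⁿ j *ⁿ 4 × toℕ i +ⁿ j *ⁿ 4 < hi *ⁿ 4
index-bounds {j = j} i lo≤j j<hi =
  ℕₚ.≤-trans (ℕₚ.*-monoˡ-≤ 4 lo≤j) (ℕₚ.m≤n+m _ (toℕ i)) ,
  ℕₚ.≤-trans (ℕₚ.+-monoˡ-≤ (j *ⁿ 4) (Finₚ.toℕ<n i)) (ℕₚ.*-monoˡ-≤ 4 j<hi)

module _ (s t : Sign) (ss : List Sign) (p : Point) (d : Dir) where
  open Unfold s t ss p d

  visits-unfold : ∀ {lo hi} u τ i → Visits coarse lo hi (u ⊞ τ) →
                  Visits fine (lo *ⁿ 4) (hi *ⁿ 4) ((p ⊕ double u) ⊞ unfold s β i τ)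
  visits-unfold u τ i (j , lo≤j , j<hi , eq) =
    let lo , hi = index-bounds i lo≤j j<hi
    in toℕ i +ⁿ j *ⁿ 4 , lo , hi , (begin
      fine (toℕ i +ⁿ j *ⁿ 4)            ≡⟨ fine≡unfold i j ⟩
      p ⊞ unfold s β i (coarse j)       ≡⟨ cong (λ z → p ⊞ unfold s β i z) eq ⟩
      p ⊞ unfold s β i (u ⊞ τ)          ≡⟨ cong (p ⊞_) (unfold-⊞ s β i u τ) ⟩
      p ⊞ (double u ⊞ unfold s β i τ)   ≡⟨ sym (⊞-assoc p (double u) _) ⟩
      (p ⊕ double u) ⊞ unfold s β i τ   ∎)
    where open ≡-Reasoning

-- Picks the orientation of the edge that has colour `b`; by `colour-support` there is only one.
orient : Bool → Edge → Segment
orient b (P , horiz) = if pointParity P xor b then (P ⊕ step east , west) else (P , east)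
orient b (P , vert)  = if pointParity P xor b then (P , north) else (P ⊕ step north , south)

support-orient : ∀ b e → support (orient b e) ≡ e
support-orient b (P , horiz) with pointParity P xor b
... | true  = cong (_, horiz) (trans (⊕-assoc P _ _) (⊕-identityʳ P))
... | false = refl
support-orient b (P , vert) with pointParity P xor b
... | true  = refl
... | false = cong (_, vert) (trans (⊕-assoc P _ _) (⊕-identityʳ P))

colour-orient : ∀ b e → colour (orient b e) ≡ b
colour-orient b (P , horiz) with pointParity P in q | b
... | false | false rewrite q = refl
... | true  | true  rewrite q = refl
... | false | true  rewrite pointParity-⊕ P (step east) | q = refl
... | true  | false rewrite pointParity-⊕ P (step east) | q = refl
colour-orient b (P , vert) with pointParity P in q | b
... | false | true rewrite q = refl
... | true  | false  rewrite q = refl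
... | false | false  rewrite pointParity-⊕ P (step north) | q = refl
... | true  | true rewrite pointParity-⊕ P (step north) | q = refl

-- The colour is constant along the walk, so a covered edge is traversed in a known direction;
-- translating by `u` changes the colour by the parity of `u`.
covers⇒visits : ∀ f σ {lo hi} u e → Covers (walk f σ) lo hi (translateE u e) →
                Visits (walk f σ) lo hi (u ⊞ orient (pointParity u xor colour σ) e)
covers⇒visits f σ u e (k , lo , hi , eq) = k , lo , hi , colour-support _ _
  (trans (colour-walk f σ k) (sym (trans (colour-⊞ u _) (trans (cong (pointParity u xor_) (colour-orient _ e)) (xor-cancel (pointParity u) _)))))
  (trans eq (sym (trans (support-⊞ u _) (cong (translateE u) (support-orient _ e)))))

-- Full squares of side 3, by finite checks

_≟Axis_ : DecidableEquality Axis
horiz ≟Axis horiz = yes refl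
horiz ≟Axis vert  = no λ ()
vert  ≟Axis horiz = no λ ()
vert  ≟Axis vert  = yes refl

_≟Edge_ : DecidableEquality Edge
_≟Edge_ = ≡-dec _≟Point_ _≟Axis_

allSigns? : ∀ {P : Sign → Set} → (∀ s → Dec (P s)) → Dec (∀ s → P s)
allSigns? P? = map′ (λ (p , m) → signs p m) (λ f → f plus , f minus) (P? plus ×-dec P? minus)

allBools? : ∀ {P : Bool → Set} → (∀ s → Dec (P s)) → Dec (∀ s → P s)
allBools? P? = map′ (λ { (p , m) false → p ; (p , m) true → m }) (λ f → f false , f true) (P? false ×-dec P? true)

allDirs? : ∀ {P : Dir → Set} → (∀ s → Dec (P s)) → Dec (∀ s → P s)
allDirs? P? = map′ (λ (e , n , w , s) → dirs e n w s) (λ f → f east , f north , f west , f south)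
  (P? east ×-dec (P? north ×-dec (P? west ×-dec P? south)))

squareEdges : ℕ → List Edge
squareEdges w =
  cartesianProductWith (λ x y → (+ x , + y) , horiz) (upTo w) (upTo (suc w)) ++
  cartesianProductWith (λ x y → (+ x , + y) , vert) (upTo (suc w)) (upTo w)

starEdges : List Edge
starEdges = map (λ d → support (origin , d)) (east ∷ north ∷ west ∷ south ∷ [])

-- Quantifying over the colour and both unfolding signs makes one finite check valid everywhere
-- along every walk.
Reaches : List Edge → Edge → Set
Reaches E e = ∀ b α β → Any (λ e' → Σ (Fin 4) λ i → support (unfold α β i (orient b e')) ≡ e) E

reaches? : ∀ E e → Dec (Reaches E e)
reaches? E e = allBools? λ b → allSigns? λ α → allSigns? λ β →
  Any.any? (λ e' → Finₚ.any? λ i → support (unfold α β i (orient b e')) ≟Edge e) E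

-- The origin stands for a doubled coarse vertex; the coarse edges at a vertex suffice to produce
-- all fine edges there.
star-reaches : ∀ d → Reaches starEdges (support (origin , d))
star-reaches = toWitness {a? = allDirs? λ d → reaches? starEdges (support (origin , d))} _

-- The point (1, 1) is the centre of the doubled unit cell, and the four sides of the cell suffice
-- to produce all fine edges at that centre.
cell-reaches : ∀ d → Reaches (squareEdges 1) (support ((1ℤ , 1ℤ) , d))
cell-reaches = toWitness {a? = allDirs? λ d → reaches? (squareEdges 1) (support ((1ℤ , 1ℤ) , d))} _

unfoldAll : Sign → Sign → List Segment → List Segment
unfoldAll α β []      = []
unfoldAll α β (τ ∷ X) = unfold α β 0F τ ∷ unfold α β 1F τ ∷ unfold α β 2F τ ∷ unfold α β 3F τ ∷ unfoldAll α β X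

Contains : List Segment → Point → List Segment → Set
Contains X v Y = All (λ τ → (v ⊞ τ) ∈ X) Y

-- Covers two unfoldings with arbitrary signs. Any member of `Ys` may be found, so a square may
-- appear in either colour.
Grows : List (List Segment) → (List Segment → List Point) → List (List Segment) → Set
Grows Xs shifts Ys = All (λ X → ∀ α β α' β' → let Z = unfoldAll α' β' (unfoldAll α β X) in
  Any (λ Y → Any (λ v → Contains Z v Y) (shifts Z)) Ys) Xs

grows? : ∀ Xs shifts Ys → Dec (Grows Xs shifts Ys)
grows? Xs shifts Ys = All.all? (λ X → allSigns? λ α → allSigns? λ β → allSigns? λ α' → allSigns? λ β' →
  let Z = unfoldAll α' β' (unfoldAll α β X) in
  Any.any? (λ Y → Any.any? (λ v → All.all? (λ τ → Any.any? ((v ⊞ τ) ≟Segment_) Z) Y) (shifts Z)) Ys) Xs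

singles : List (List Segment)
singles = map (λ d → (origin , d) ∷ []) (east ∷ north ∷ west ∷ south ∷ [])

squares : ℕ → List (List Segment)
squares w = map (λ b → map (orient b) (squareEdges w)) (false ∷ true ∷ [])

-- Each of the sixteen resulting segments offers its initial point as lower left corner of a unit
-- square.
single-grows : Grows singles (map initial) (squares 1)
single-grows = toWitness {a? = grows? singles (map initial) (squares 1)} _

-- The shifts were found by search.
square1-grows : Grows (squares 1) (λ _ → (+ 1 , + 1) ∷ (+ 1 , + 3) ∷ (-1ℤ , + 1) ∷ []) (squares 2)
square1-grows = toWitness {a? = grows? _ _ _} _

-- The checks go up to side 3 because the map w ↦ 2w - 2 of `full-double` fixes 2 and enlarges every
-- side from 3 on.
square2-grows : Grows (squares 2) (λ _ → (+ 2 , + 2) ∷ []) (squares 3)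
square2-grows = toWitness {a? = grows? _ _ _} _

VisitsPattern : (ℕ → Segment) → ℕ → ℕ → List (List Segment) → Set
VisitsPattern Q lo hi Xs = Σ Point λ u → Any (λ X → All (λ τ → Visits Q lo hi (u ⊞ τ)) X) Xs

visits-unfoldAll : ∀ s t ss p d {lo hi} u {X} → let open Unfold s t ss p d in
  All (λ τ → Visits coarse lo hi (u ⊞ τ)) X →
  All (λ τ → Visits fine (lo *ⁿ 4) (hi *ⁿ 4) ((p ⊕ double u) ⊞ τ)) (unfoldAll s β X)
visits-unfoldAll s t ss p d u []             = []
visits-unfoldAll s t ss p d u (_∷_ {x = τ} v vs) =
  visits-unfold s t ss p d u τ 0F v ∷ visits-unfold s t ss p d u τ 1F v ∷
  visits-unfold s t ss p d u τ 2F v ∷ visits-unfold s t ss p d u τ 3F v ∷ visits-unfoldAll s t ss p d u vs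

visits-grows : ∀ {Xs} shifts {Ys} → Grows Xs shifts Ys → ∀ {n lo hi} →
  (∀ ss σ → n ≤ⁿ length ss → VisitsPattern (walk (paper ss) σ) lo hi Xs) →
  ∀ ss σ → 4 +ⁿ n ≤ⁿ length ss → VisitsPattern (walk (paper ss) σ) (lo *ⁿ 4 *ⁿ 4) (hi *ⁿ 4 *ⁿ 4) Ys
visits-grows {Xs} shifts {Ys} grows {n} {lo} {hi} visits
  (s ∷ t ∷ s' ∷ t' ∷ ss) (p , d) (s≤s (s≤s (s≤s (s≤s deep))))
  with visits ss (origin , foldedDir s' t' (foldedDir s t d)) deep
... | u , some with find some
...   | X , X∈ , vs = w ⊕ v , lose Y∈ (All.map moved contained)
  where
  fine : ℕ → Segment
  fine = walk (paper (s ∷ t ∷ s' ∷ t' ∷ ss)) (p , d)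
  w : Point
  w = p ⊕ double (origin ⊕ double u)
  -- The folds `s` and `t` are the finest, so the pattern of the coarsest walk is unfolded with `s'`
  -- first and with `s` last.
  Z : List Segment
  Z = unfoldAll s (foldedSign s t d) (unfoldAll s' (foldedSign s' t' (foldedDir s t d)) X)
  all : All (λ τ → Visits fine (lo *ⁿ 4 *ⁿ 4) (hi *ⁿ 4 *ⁿ 4) (w ⊞ τ)) Z
  all = visits-unfoldAll s t (s' ∷ t' ∷ ss) p d (origin ⊕ double u)
          (visits-unfoldAll s' t' ss origin (foldedDir s t d) u vs)
  grown : Any (λ Y → Any (λ v → Contains Z v Y) (shifts Z)) Ys
  grown = All.lookup grows X∈ s' (foldedSign s' t' (foldedDir s t d)) s (foldedSign s t d)
  Y  = proj₁ (find grown)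
  Y∈ = proj₁ (proj₂ (find grown))
  v  = proj₁ (find (proj₂ (proj₂ (find grown))))
  contained : Contains Z v Y
  contained = proj₂ (proj₂ (find (proj₂ (proj₂ (find grown)))))
  moved : ∀ {τ} → (v ⊞ τ) ∈ Z → Visits fine (lo *ⁿ 4 *ⁿ 4) (hi *ⁿ 4 *ⁿ 4) ((w ⊕ v) ⊞ τ)
  moved {τ} ∈Z = subst (Visits fine _ _) (sym (⊞-assoc w v τ)) (All.lookup all ∈Z)

visits-single : ∀ f σ T → VisitsPattern (walk f σ) T (suc T) singles
visits-single f σ T with walk f σ T in eq
... | P , d = P , pick d λ e → (T , ℕₚ.≤-refl , ℕₚ.≤-refl , trans eq (cong₂ _,_ (sym (⊕-identityʳ P)) e)) ∷ []
  where
  pick : ∀ {V : Segment → Set} d → (∀ {d'} → d ≡ d' → All V ((origin , d') ∷ [])) → Any (All V) singles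
  pick east  v = here (v refl)
  pick north v = there (here (v refl))
  pick west  v = there (there (here (v refl)))
  pick south v = there (there (there (here (v refl))))

visits-square⇒full : ∀ {Q lo hi w} → VisitsPattern Q lo hi (squares w) → Σ Point λ c → Full Q lo hi c w
visits-square⇒full {Q} {lo} {hi} {w} (u , some) = u , pick some
  where
  full : ∀ b → All (λ τ → Visits Q lo hi (u ⊞ τ)) (map (orient b) (squareEdges w)) → Full Q lo hi u w
  full b vs =
    (λ x y x<w y≤w → covers (∈-++⁺ˡ (∈-cartesianProductWith⁺ _ (∈-upTo⁺ x<w) (∈-upTo⁺ (s≤s y≤w))))) ,
    (λ x y x≤w y<w → covers (∈-++⁺ʳ (cartesianProductWith (λ x y → (+ x , + y) , horiz) (upTo w) (upTo (suc w))) (∈-cartesianProductWith⁺ (λ x y → (+ x , + y) , vert) (∈-upTo⁺ (s≤s x≤w)) (∈-upTo⁺ y<w))))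
    where
    covers : ∀ {e} → e ∈ squareEdges w → Covers Q lo hi (translateE u e)
    covers {e} e∈ =
      let k , lo≤k , k<hi , eq = All.lookup vs (∈-map⁺ (orient b) e∈)
      in k , lo≤k , k<hi , trans (cong support eq) (trans (support-⊞ u _) (cong (translateE u) (support-orient b e)))
  pick : Any (λ X → All (λ τ → Visits Q lo hi (u ⊞ τ)) X) (squares w) → Full Q lo hi u w
  pick (here vs)         = full false vs
  pick (there (here vs)) = full true vs

-- Doubling full squares

module _ (s t : Sign) (ss : List Sign) (p : Point) (d : Dir) where
  open Unfold s t ss p d

  covers-reached : ∀ {E e lo hi} u → Reaches E e → All (λ e' → Covers coarse lo hi (translateE u e')) E →
                   Covers fine (lo *ⁿ 4) (hi *ⁿ 4) (translateE (p ⊕ double u) e)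
  covers-reached {E} {e} u reaches covered =
    let e' , e'∈ , i , reached = find (reaches b s β)
        k , lo , hi , eq = visits-unfold s t ss p d u (orient b e') i
          (covers⇒visits (paper ss) (origin , foldedDir s t d) u e' (All.lookup covered e'∈))
    in k , lo , hi , trans (cong support eq) (trans (support-⊞ (p ⊕ double u) _) (cong (translateE (p ⊕ double u)) reached))
    where
    b = pointParity u xor colour (origin , foldedDir s t d)

  module _ {lo hi c m} (full : Full coarse lo hi c (2 +ⁿ m)) where

    private
      row : ∀ {x y e} → x < 2 +ⁿ m → y ≤ⁿ 2 +ⁿ m → (c ⊕ (+ x , + y) , horiz) ≡ e → Covers coarse lo hi e
      row x< y≤ refl = proj₁ full _ _ x< y≤

      column : ∀ {x y e} → x ≤ⁿ 2 +ⁿ m → y < 2 +ⁿ m → (c ⊕ (+ x , + y) , vert) ≡ e → Covers coarse lo hi e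
      column x≤ y< refl = proj₂ full _ _ x≤ y<

    -- All cells of the coarse square qualify, including those at its boundary, since their sides
    -- belong to it.
    covers-cell : ∀ a b δ → a ≤ⁿ suc m → b ≤ⁿ suc m →
      Covers fine (lo *ⁿ 4) (hi *ⁿ 4) (translateE (p ⊕ double (c ⊕ (+ a , + b))) (support ((1ℤ , 1ℤ) , δ)))
    covers-cell a b δ a≤ b≤ = covers-reached (c ⊕ (+ a , + b)) (cell-reaches δ)
      ( row (s≤s a≤) (ℕₚ.m≤n⇒m≤1+n b≤) (cong (_, horiz) (sym (⊕-identityʳ _)))
      ∷ row (s≤s a≤) (s≤s b≤) (cong (_, horiz) (shift (+ 0) (+ 1)))
      ∷ column (ℕₚ.m≤n⇒m≤1+n a≤) (s≤s b≤) (cong (_, vert) (sym (⊕-identityʳ _)))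
      ∷ column (s≤s a≤) (s≤s b≤) (cong (_, vert) (shift (+ 1) (+ 0)))
      ∷ [])
      where
      shift : ∀ u v → c ⊕ (u + + a , v + + b) ≡ (c ⊕ (+ a , + b)) ⊕ (u , v)
      shift u v = trans (cong (c ⊕_) (⊕-comm (u , v) (+ a , + b))) (sym (⊕-assoc c (+ a , + b) (u , v)))

    -- Only an interior vertex has all four of its edges in the coarse square, hence the coordinates
    -- `suc a` and `suc b`.
    covers-star : ∀ a b δ → a ≤ⁿ m → b ≤ⁿ m →
      Covers fine (lo *ⁿ 4) (hi *ⁿ 4) (translateE (p ⊕ double (c ⊕ (+ suc a , + suc b))) (support (origin , δ)))
    covers-star a b δ a≤ b≤ = covers-reached (c ⊕ (+ suc a , + suc b)) (star-reaches δ)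
      ( row (s≤s (s≤s a≤)) (s≤s (ℕₚ.m≤n⇒m≤1+n b≤)) (cong (_, horiz) (sym (⊕-identityʳ _)))
      ∷ column (s≤s (ℕₚ.m≤n⇒m≤1+n a≤)) (s≤s (s≤s b≤)) (cong (_, vert) (sym (⊕-identityʳ _)))
      ∷ row (s≤s (ℕₚ.m≤n⇒m≤1+n a≤)) (s≤s (ℕₚ.m≤n⇒m≤1+n b≤)) (cong (_, horiz) (back west (cong (+ a ,_) (sym (ℤₚ.+-identityʳ (+ suc b))))))
      ∷ column (s≤s (ℕₚ.m≤n⇒m≤1+n a≤)) (s≤s (ℕₚ.m≤n⇒m≤1+n b≤)) (cong (_, vert) (back south (cong (_, + b) (sym (ℤₚ.+-identityʳ (+ suc a))))))
      ∷ [])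
      where
      back : ∀ d {P} → P ≡ (+ suc a , + suc b) ⊕ step d → c ⊕ P ≡ (c ⊕ (+ suc a , + suc b)) ⊕ (origin ⊕ step d)
      back d refl = trans (sym (⊕-assoc c _ (step d))) (cong ((c ⊕ (+ suc a , + suc b)) ⊕_) (sym (⊕-identityˡ (step d))))

parity-view : ∀ n → Σ ℕ λ a → (n ≡ a +ⁿ a) ⊎ (n ≡ suc (a +ⁿ a))
parity-view zero    = 0 , inj₁ refl
parity-view (suc n) with parity-view n
... | a , inj₁ refl = a , inj₂ refl
... | a , inj₂ refl = suc a , inj₁ (cong suc (sym (ℕₚ.+-suc a a)))

even-after : ∀ p c A → (p + ((c + c) + 1ℤ)) + (A + A) ≡ (p + ((c + A) + (c + A))) + 1ℤ
even-after = solve-∀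

even-before : ∀ p c A → (p + ((c + c) + 1ℤ)) + (A + A) ≡ (p + ((c + (1ℤ + A)) + (c + (1ℤ + A)))) + -1ℤ
even-before = solve-∀

odd-at : ∀ p c A → (p + ((c + c) + 1ℤ)) + (1ℤ + (A + A)) ≡ (p + ((c + (1ℤ + A)) + (c + (1ℤ + A)))) + 0ℤ
odd-at = solve-∀

-- Relative to `p`, a fine edge has exactly one endpoint with coordinates of equal parity: a doubled
-- coarse vertex or the centre of a doubled coarse cell. The fine square spans the centres of the
-- extreme cells, so each such endpoint in it comes from an interior vertex or a cell of the coarse
-- square.
full-double : ∀ s t ss p d {lo hi c m} → let open Unfold s t ss p d in
  Full coarse lo hi c (2 +ⁿ m) →
  Full fine (lo *ⁿ 4) (hi *ⁿ 4) (p ⊕ (double c ⊕ (1ℤ , 1ℤ))) (2 +ⁿ (m +ⁿ m))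
full-double s t ss p@(px , py) d {lo} {hi} {c@(cx , cy)} {m} full = horizontals , verticals
  where
  open Unfold s t ss p d

  target : Point
  target = p ⊕ (double c ⊕ (1ℤ , 1ℤ))

  via : ∀ {P Q a} → P ≡ Q → Covers fine (lo *ⁿ 4) (hi *ⁿ 4) (Q , a) → Covers fine (lo *ⁿ 4) (hi *ⁿ 4) (P , a)
  via refl v = v

  strict : ∀ {a} → a +ⁿ a < 2 +ⁿ (m +ⁿ m) → a ≤ⁿ m
  strict (s≤s le) = double-cancel-≤ le

  weak : ∀ {a} → a +ⁿ a ≤ⁿ 2 +ⁿ (m +ⁿ m) → a ≤ⁿ suc m
  weak le = double-cancel-≤ (ℕₚ.m≤n⇒m≤1+n (ℕₚ.≤-trans le (ℕₚ.≤-reflexive (cong suc (sym (ℕₚ.+-suc m m))))))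

  up : ∀ {a} → a ≤ⁿ m → a ≤ⁿ suc m
  up = ℕₚ.m≤n⇒m≤1+n

  horizontals : ∀ x y → x < 2 +ⁿ (m +ⁿ m) → y ≤ⁿ 2 +ⁿ (m +ⁿ m) →
                Covers fine (lo *ⁿ 4) (hi *ⁿ 4) (target ⊕ (+ x , + y) , horiz)
  -- The corner `target` is a cell centre: even offsets from it are coordinates of centres, odd ones
  -- of doubled vertices. In the mixed cases the right endpoint of the edge is the one to use, in
  -- direction `west`.
  horizontals x y x< y≤ with parity-view x | parity-view y
  ... | a , inj₁ refl | b , inj₁ refl = via (cong₂ _,_ (even-after px cx (+ a)) (even-after py cy (+ b)))
    (covers-cell s t ss p d {c = c} full a b east (up (strict x<)) (weak y≤))
  ... | a , inj₁ refl | b , inj₂ refl = via (cong₂ _,_ (even-before px cx (+ a)) (odd-at py cy (+ b)))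
    (covers-star s t ss p d {c = c} full a b west (strict x<) (strict y≤))
  ... | a , inj₂ refl | b , inj₁ refl = via (cong₂ _,_ (odd-at px cx (+ a)) (even-after py cy (+ b)))
    (covers-cell s t ss p d {c = c} full (suc a) b west (s≤s (strict (ℕₚ.<⇒≤ x<))) (weak y≤))
  ... | a , inj₂ refl | b , inj₂ refl = via (cong₂ _,_ (odd-at px cx (+ a)) (odd-at py cy (+ b)))
    (covers-star s t ss p d {c = c} full a b east (strict (ℕₚ.<⇒≤ x<)) (strict y≤))

  verticals : ∀ x y → x ≤ⁿ 2 +ⁿ (m +ⁿ m) → y < 2 +ⁿ (m +ⁿ m) →
              Covers fine (lo *ⁿ 4) (hi *ⁿ 4) (target ⊕ (+ x , + y) , vert)
  verticals x y x≤ y< with parity-view x | parity-view y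
  ... | a , inj₁ refl | b , inj₁ refl = via (cong₂ _,_ (even-after px cx (+ a)) (even-after py cy (+ b)))
    (covers-cell s t ss p d {c = c} full a b north (weak x≤) (up (strict y<)))
  ... | a , inj₁ refl | b , inj₂ refl = via (cong₂ _,_ (even-after px cx (+ a)) (odd-at py cy (+ b)))
    (covers-cell s t ss p d {c = c} full a (suc b) south (weak x≤) (s≤s (strict (ℕₚ.<⇒≤ y<))))
  ... | a , inj₂ refl | b , inj₁ refl = via (cong₂ _,_ (odd-at px cx (+ a)) (even-before py cy (+ b)))
    (covers-star s t ss p d {c = c} full a b south (strict x≤) (strict y<))
  ... | a , inj₂ refl | b , inj₂ refl = via (cong₂ _,_ (odd-at px cx (+ a)) (odd-at py cy (+ b)))
    (covers-star s t ss p d {c = c} full a b north (strict x≤) (strict (ℕₚ.<⇒≤ y<)))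

scale : ℕ → ℕ → ℕ
scale zero    T = T
scale (suc n) T = scale n T *ⁿ 4

-- Three checks of two unfoldings each lead from segment `T` of the coarsest walk to side 3; after
-- that, 2w - 2 turns 2 + 2^M into 2 + 2^(M+1).
full-square : ∀ M ss σ T → (M +ⁿ 6) *ⁿ 2 ≤ⁿ length ss →
  Σ Point λ c → Full (walk (paper ss) σ) (scale (M +ⁿ 6) T) (scale (M +ⁿ 6) (suc T)) c (2 +ⁿ 2 ^ M)
full-square zero ss σ T deep = visits-square⇒full
  (visits-grows _ square2-grows
    (visits-grows _ square1-grows
      (visits-grows (map initial) single-grows λ ss σ _ → visits-single (paper ss) σ T)) ss σ deep)
full-square (suc M) (s ∷ t ∷ ss) (p , d) T (s≤s (s≤s deep)) =
  let c , full = full-square M ss (origin , foldedDir s t d) T deep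
      c' = p ⊕ (double c ⊕ (1ℤ , 1ℤ))
  in c' , subst (λ w → Full (Unfold.fine s t ss p d) (scale (M +ⁿ 6) T *ⁿ 4) (scale (M +ⁿ 6) (suc T) *ⁿ 4) c' (2 +ⁿ (2 ^ M +ⁿ w)))
            (sym (ℕₚ.+-identityʳ (2 ^ M)))
            (full-double s t ss p d {c = c} full)

-- Windows of complete folding curves

rotate-turn : ∀ d d' → Perp d d' → d' ≡ rotate (turn d d') d
rotate-turn east  _ (inj₁ refl) = refl
rotate-turn north _ (inj₁ refl) = refl
rotate-turn west  _ (inj₁ refl) = refl
rotate-turn south _ (inj₁ refl) = refl
rotate-turn east  _ (inj₂ refl) = refl
rotate-turn north _ (inj₂ refl) = refl
rotate-turn west  _ (inj₂ refl) = refl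
rotate-turn south _ (inj₂ refl) = refl

previous : Sign → Segment → Segment
previous ε (P , d) = let d' = rotate (opposite ε) d in P ⊕ step (rotL (rotL d')) , d'

next-previous : ∀ ε τ → next ε (previous ε τ) ≡ τ
next-previous ε (P , d) = cong₂ _,_
  (trans (⊕-assoc P _ _) (trans (cong (P ⊕_) (step-back (rotate (opposite ε) d))) (⊕-identityʳ P))) (rotate-back ε d)
  where
  step-back : ∀ d → step (rotL (rotL d)) ⊕ step d ≡ origin
  step-back = dirs refl refl refl refl
  rotate-back : ∀ ε d → rotate ε (rotate (opposite ε) d) ≡ d
  rotate-back plus  = dirs refl refl refl refl
  rotate-back minus = dirs refl refl refl refl

walk-through : ∀ f t τ → Σ Segment λ σ → walk f σ t ≡ τ
walk-through f zero    τ = τ , refl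
walk-through f (suc t) τ =
  let σ , eq = walk-through f t (previous (f (suc t)) τ)
  in σ , trans (cong (next (f (suc t))) eq) (next-previous (f (suc t)) τ)

module _ (c : CompleteCurve) where
  open CompleteCurve c

  seg-next : ∀ i → seg (i + + 1) ≡ next (assoc i) (seg i)
  seg-next i = cong₂ _,_ (sym (chained i)) (rotate-turn _ _ (perp i))

  window-walk : IsCompleteFoldingCurve c → ∀ pad m → Σ (List Sign) λ ss → length pad ≤ⁿ length ss ×
    Σ ℕ λ t → Σ Segment λ σ → ∀ j → j ≤ⁿ m → seg (+ suc j) ≡ walk (paper ss) σ (t +ⁿ j)
  window-walk folding pad m with folding 0ℤ m
  ... | n , S , isFolding , u , v , S≡ with folding-paper pad isFolding
  ...   | ss , pad≤ , agree = ss , pad≤ , length u , σ , along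
    where
    f : ℕ → Sign
    f = paper ss
    -- Turns can be undone, so some walk has `seg (+ 1)` at index `length u`, where the window
    -- begins in the folding sequence.
    σ : Segment
    σ = proj₁ (walk-through f (length u) (seg (+ 1)))
    turns-agree : ∀ {j} → j < m → assoc (+ suc j) ≡ f (suc (length u +ⁿ j))
    turns-agree = agree-applyUpTo _ (λ j → assoc (+ suc j)) m
      (subst (Agree _) (map-applyUpTo id (λ j → assoc (+ suc j)) m)
        (agree-prefix _ (window assoc 0ℤ m)
          (agree-suffix (f ∘ suc) u (subst (Agree (f ∘ suc)) S≡ agree))))
    along : ∀ j → j ≤ⁿ m → seg (+ suc j) ≡ walk f σ (length u +ⁿ j)
    along zero    _   = sym (trans (cong (walk f σ) (ℕₚ.+-identityʳ (length u))) (proj₂ (walk-through f (length u) (seg (+ 1)))))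
    along (suc j) j<m = begin
      seg (+ suc (suc j))                                        ≡⟨ cong (λ n → seg (+ suc n)) (ℕₚ.+-comm 1 j) ⟩
      seg (+ suc j + + 1)                                        ≡⟨ seg-next (+ suc j) ⟩
      next (assoc (+ suc j)) (seg (+ suc j))                     ≡⟨ cong₂ next (turns-agree j<m) (along j (ℕₚ.<⇒≤ j<m)) ⟩
      walk f σ (suc (length u +ⁿ j))                             ≡⟨ cong (walk f σ) (sym (ℕₚ.+-suc (length u) j)) ⟩
      walk f σ (length u +ⁿ suc j)                               ∎
      where open ≡-Reasoning

-- Disks, squares and aligned blocks of indices

covers-inside : ∀ {Q lo hi c w} → Full Q lo hi c w → ∀ P d → InSquare c w P → InSquare c w (P ⊕ step d) →
                Covers Q lo hi (support (P , d))
covers-inside {c = c} {w} (horizontal , vertical) = λ where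
    P east  (x , y , x≤ , y≤ , refl) (x' , y' , x'≤ , y'≤ , eq) →
      horizontal x y (subst (_≤ⁿ w) (stepped x x' (cong proj₁ (shift east eq))) x'≤) y≤
    P north (x , y , x≤ , y≤ , refl) (x' , y' , x'≤ , y'≤ , eq) →
      vertical x y x≤ (subst (_≤ⁿ w) (stepped y y' (cong proj₂ (shift north eq))) y'≤)
    P west  (x , y , x≤ , y≤ , refl) (x' , y' , x'≤ , y'≤ , eq) →
      subst (Covers _ _ _) (cong (_, horiz) (sym eq))
        (horizontal x' y' (subst (_≤ⁿ w) (stepped x' x (cong proj₁ (shift east (back east west refl eq)))) x≤) y'≤)
    P south (x , y , x≤ , y≤ , refl) (x' , y' , x'≤ , y'≤ , eq) →
      subst (Covers _ _ _) (cong (_, vert) (sym eq))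
        (vertical x' y' x'≤ (subst (_≤ⁿ w) (stepped y' y (cong proj₂ (shift north (back north south refl eq)))) y≤))
  where
  shift : ∀ d {P R} → (c ⊕ P) ⊕ step d ≡ c ⊕ R → P ⊕ step d ≡ R
  shift d {P} eq = ⊕-cancelˡ c (trans (sym (⊕-assoc c P (step d))) eq)
  stepped : ∀ x x' → + x + + 1 ≡ + x' → x' ≡ suc x
  stepped x x' eq = trans (sym (ℤₚ.+-injective eq)) (ℕₚ.+-comm x 1)
  back : ∀ {P R} d d' → step d' ⊕ step d ≡ origin → P ⊕ step d' ≡ R → R ⊕ step d ≡ P
  back {P} d d' cancel refl = trans (⊕-assoc P _ _) (trans (cong (P ⊕_) cancel) (⊕-identityʳ P))

square-≤ : ∀ z r → z * z ℤ.≤ + r * + r → ∣ z ∣ ≤ⁿ r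
square-≤ z r le with ∣ z ∣ ℕₚ.≤? r
... | yes p = p
... | no ¬p = contradiction (ℤₚ.drop‿+≤+ (subst₂ ℤ._≤_ (square z) (sym (ℤₚ.pos-* r r)) le)) (ℕₚ.<⇒≱ (ℕₚ.*-mono-< r<z r<z))
  where
  r<z = ℕₚ.≰⇒> ¬p
  square : ∀ z → z * z ≡ + (∣ z ∣ *ⁿ ∣ z ∣)
  square (+ n)    = sym (ℤₚ.pos-* n n)
  square -[1+ n ] = refl

square-nonneg : ∀ z → 0ℤ ℤ.≤ z * z
square-nonneg (+ n)    = subst (0ℤ ℤ.≤_) (ℤₚ.pos-* n n) (ℤ.+≤+ z≤n)
square-nonneg -[1+ n ] = ℤ.+≤+ z≤n

nonneg-shift : ∀ z {r} → ∣ z ∣ ≤ⁿ r → Σ ℕ λ n → n ≤ⁿ r +ⁿ r × z + + r ≡ + n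
nonneg-shift (+ k)    {r} le = k +ⁿ r , ℕₚ.+-monoˡ-≤ r le , refl
nonneg-shift -[1+ k ] {r} le = r ∸ suc k , ℕₚ.≤-trans (ℕₚ.m∸n≤m r (suc k)) (ℕₚ.m≤m+n r r) , ℤₚ.⊖-≥ le

disk-in-square : ∀ c r {w} → r +ⁿ r ≤ⁿ w → ∀ P → InDisk (c ⊕ (+ r , + r)) r P → InSquare c w P
disk-in-square (cx , cy) r 2r≤w (a , b) le =
  let z = a - (cx + + r)
      z' = b - (cy + + r)
      x , x≤ , eqx = nonneg-shift z (square-≤ z r (ℤₚ.≤-trans (ℤₚ.≤-trans (ℤₚ.≤-reflexive (sym (ℤₚ.+-identityʳ (z * z)))) (ℤₚ.+-monoʳ-≤ (z * z) (square-nonneg z'))) le))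
      y , y≤ , eqy = nonneg-shift z' (square-≤ z' r (ℤₚ.≤-trans (ℤₚ.≤-trans (ℤₚ.≤-reflexive (sym (ℤₚ.+-identityˡ (z' * z')))) (ℤₚ.+-monoˡ-≤ (z' * z') (square-nonneg z))) le))
  in x , y , ℕₚ.≤-trans x≤ 2r≤w , ℕₚ.≤-trans y≤ 2r≤w ,
     cong₂ _,_ (trans (recentre a cx (+ r)) (cong (λ z → cx + z) eqx)) (trans (recentre b cy (+ r)) (cong (λ z → cy + z) eqy))
  where
  recentre : ∀ a c r → a ≡ c + ((a - (c + r)) + r)
  recentre = solve-∀

bounded : ∀ n (g : Fin n → ℕ) → Σ ℕ λ B → ∀ i → g i ≤ⁿ B
bounded zero    g = 0 , λ ()
bounded (suc n) g =
  let B , g≤ = bounded n (g ∘ suc)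
  in g zero +ⁿ B , λ { zero → ℕₚ.m≤m+n (g zero) B ; (suc i) → ℕₚ.≤-trans (g≤ i) (ℕₚ.m≤n+m B (g zero)) }

n≤2^n : ∀ n → n ≤ⁿ 2 ^ n
n≤2^n zero    = z≤n
n≤2^n (suc n) = ℕₚ.≤-trans (ℕₚ.+-mono-≤ (ℕₚ.m^n>0 2 n) (n≤2^n n)) (ℕₚ.≤-reflexive (cong (2 ^ n +ⁿ_) (sym (ℕₚ.+-identityʳ (2 ^ n)))))

-- A window length that forces an aligned block of 4^n indices into the window; each level adds 4
-- for rounding up.
margin : ℕ → ℕ
margin zero    = 1
margin (suc n) = 4 +ⁿ margin n *ⁿ 4

aligned-block : ∀ n t → Σ ℕ λ T → t ≤ⁿ scale n T × scale n (suc T) ≤ⁿ t +ⁿ margin n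
aligned-block zero    t = t , ℕₚ.≤-refl , ℕₚ.≤-reflexive (ℕₚ.+-comm 1 t)
aligned-block (suc n) t with t divMod 4
... | result q r refl =
  -- Passing to `suc q` rounds up, so that the block does not begin before `t`.
  let T , lo , hi = aligned-block n (suc q)
  in T , ℕₚ.≤-trans (ℕₚ.+-monoˡ-≤ (q *ⁿ 4) (ℕₚ.<⇒≤ (Finₚ.toℕ<n r))) (ℕₚ.*-monoˡ-≤ 4 lo) ,
     ℕₚ.≤-trans (ℕₚ.*-monoˡ-≤ 4 hi) (ℕₚ.≤-trans (ℕₚ.≤-reflexive (rearrange q (margin n))) (ℕₚ.+-monoˡ-≤ (4 +ⁿ margin n *ⁿ 4) (ℕₚ.m≤n+m (q *ⁿ 4) (toℕ r))))
  where
  rearrange : ∀ q m → (suc q +ⁿ m) *ⁿ 4 ≡ q *ⁿ 4 +ⁿ (4 +ⁿ m *ⁿ 4)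
  rearrange = ℕSolver.solve-∀

-- Seven curves in one filled square

norm : Point → ℕ
norm (x , y) = ∣ x ∣ +ⁿ ∣ y ∣

module SevenCurves {I : Set} (C : Covering I) (f : Fin 7 → I) (f-injective : Injective _≡_ _≡_ f) (B : ℕ)
  (initial-bounded : ∀ i → norm (initial (CompleteCurve.seg (Covering.curve C (f i)) 0ℤ)) ≤ⁿ B) where
  open Covering C

  curveSeg : I → ℤ → Segment
  curveSeg i = CompleteCurve.seg (curve i)

  M L : ℕ
  -- The seven segments of index 0 start in a square of side 2B, and 2B is at most 2^(2B) + 1.
  M = B +ⁿ B
  L = radius M

  index : ℕ → ℤ
  index n = + n - + L

  index-suc : ∀ n → index n + + 1 ≡ index (suc n)
  index-suc n = rearrange (+ n) (+ L)
    where
    rearrange : ∀ a b → (a - b) + 1ℤ ≡ (1ℤ + a) - b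
    rearrange = solve-∀

  index-injective : ∀ {m n} → index m ≡ index n → m ≡ n
  index-injective eq = ℤₚ.+-injective (∙-cancelʳ (ℤ.- + L) _ _ eq)

  piecesOf : Fin 7 → List DecSeg
  piecesOf i = applyUpTo (λ n → decorated (curve (f i)) (index n)) (suc (L +ⁿ L))

  pieces : List DecSeg
  pieces = concat (tabulate piecesOf)

  pieces-decorated : All (IsDecSegOf C) pieces
  pieces-decorated = Allₚ.concat⁺ (Allₚ.tabulate⁺ {f = piecesOf} λ i →
    Allₚ.applyUpTo⁺₂ (λ n → decorated (curve (f i)) (index n)) (suc (L +ⁿ L)) λ n → f i , index n , refl)

  piece : ∀ {P : DecSeg → Set} → All P pieces → ∀ i {n} → n < suc (L +ⁿ L) → P (decorated (curve (f i)) (index n))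
  piece all i = Allₚ.applyUpTo⁻ (λ n → decorated (curve (f i)) (index n)) (suc (L +ⁿ L))
    (Allₚ.tabulate⁻ {f = piecesOf} (Allₚ.concat⁻ {xss = tabulate piecesOf} all) i)

  -- A copy v + pieces inside a square filled by the curve a consists of seven windows of the curve a.
  module _ (a : I) (ss : List Sign) (deep : M *ⁿ 2 ≤ⁿ length ss) (σ : Segment) (t m : ℕ)
    (along : ∀ j → j ≤ⁿ m → curveSeg a (+ suc j) ≡ walk (paper ss) σ (t +ⁿ j))
    (v : Point)
    (copy : ∀ i {n} → n < suc (L +ⁿ L) → IsDecSegOf C (translateD v (decorated (curve (f i)) (index n))) ×
       Σ ℕ λ j → j ≤ⁿ m × support (walk (paper ss) σ (t +ⁿ j)) ≡ support (v ⊞ curveSeg (f i) (index n))) where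

    private
      Q : ℕ → Segment
      Q = walk (paper ss) σ

    -- The copied piece and a segment of the curve `a` have the same support. Uniqueness in the
    -- covering identifies them, so they also agree in orientation and in the edge that follows.
    located : ∀ i {n} → n < suc (L +ⁿ L) → Σ ℕ λ j → j ≤ⁿ m × Q (t +ⁿ j) ≡ v ⊞ curveSeg (f i) (index n) ×
      support (curveSeg a (+ suc j + + 1)) ≡ translateE v (support (curveSeg (f i) (index n + + 1)))
    located i n< with copy i n<
    ... | (i' , k , eq) , j , j≤m , covered with unique a i' (+ suc j) k (trans (cong support (along j j≤m)) (trans covered (sym (cong (support ∘ proj₁) eq))))
    ...   | refl , refl = j , j≤m , trans (sym (along j j≤m)) (cong proj₁ eq) , cong (proj₂ ∘ proj₂) eq

    position : ∀ i {n} → n < suc (L +ⁿ L) → ℕ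
    position i n< = proj₁ (located i n<)

    -- This is where decorations matter: the edge following a piece is prescribed and occurs only
    -- once in the covering, so consecutive pieces have consecutive positions on the curve `a`.
    position-suc : ∀ i {n} (n< : n < suc (L +ⁿ L)) (sn< : suc n < suc (L +ⁿ L)) → position i sn< ≡ suc (position i n<)
    position-suc i {n} n< sn< with located i n< | located i sn<
    ... | j , j≤ , now , after | j' , j'≤ , now' , _ = ℕₚ.suc-injective (sym (ℤₚ.+-injective
      (trans (cong (λ z → + suc z) (ℕₚ.+-comm 1 j)) (proj₂ (unique a a (+ suc j + + 1) (+ suc j')
        (trans after (trans (cong (λ z → translateE v (support (curveSeg (f i) z))) (index-suc n))
          (trans (sym (support-⊞ v _)) (cong support (trans (sym now') (sym (along j' j'≤)))))))))))) 

    start : Fin 7 → ℕ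
    start i = t +ⁿ position i (s≤s z≤n)

    position-start : ∀ i n (n< : n < suc (L +ⁿ L)) → t +ⁿ position i n< ≡ start i +ⁿ n
    position-start i zero    (s≤s z≤n) = sym (ℕₚ.+-identityʳ _)
    position-start i (suc n) n<  = begin
      t +ⁿ position i n<                        ≡⟨ cong (t +ⁿ_) (position-suc i (ℕₚ.<⇒≤ n<) n<) ⟩
      t +ⁿ suc (position i (ℕₚ.<⇒≤ n<))         ≡⟨ ℕₚ.+-suc t _ ⟩
      suc (t +ⁿ position i (ℕₚ.<⇒≤ n<))         ≡⟨ cong suc (position-start i n (ℕₚ.<⇒≤ n<)) ⟩
      suc (start i +ⁿ n)                        ≡⟨ sym (ℕₚ.+-suc (start i) n) ⟩
      start i +ⁿ suc n                          ∎
      where open ≡-Reasoning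

    on-window : ∀ i {n} → n ≤ⁿ L +ⁿ L → Q (start i +ⁿ n) ≡ v ⊞ curveSeg (f i) (index n)
    on-window i {n} n≤ = trans (cong Q (sym (position-start i n (s≤s n≤)))) (proj₁ (proj₂ (proj₂ (located i (s≤s n≤)))))

    centre : Fin 7 → ℕ
    centre i = start i +ⁿ L

    in-window : ∀ i {x} → Near L (centre i) x → Σ ℕ λ n → n ≤ⁿ L +ⁿ L × x ≡ start i +ⁿ n
    in-window i {x} (lo , hi) = x ∸ start i ,
      ℕₚ.≤-trans (ℕₚ.∸-monoˡ-≤ (start i) hi) (ℕₚ.≤-reflexive (trans (cong (_∸ start i) (ℕₚ.+-assoc (start i) L L)) (ℕₚ.m+n∸m≡n (start i) (L +ⁿ L)))) ,
      sym (ℕₚ.m+[n∸m]≡n (ℕₚ.+-cancelʳ-≤ L _ _ lo))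

    -- Undoing the translation by `v` turns a coincidence into one among the original seven curves,
    -- where uniqueness and the injectivity of `f` apply.
    separated : Separated L Q centre
    separated i i' x x' near near' eq with in-window i near | in-window i' near'
    ... | n , n≤ , refl | n' , n'≤ , refl
      with unique (f i) (f i') (index n) (index n') (translateE-injective v
             (trans (sym (support-⊞ v _)) (trans (cong support (trans (sym (on-window i n≤)) (trans eq (on-window i' n'≤)))) (support-⊞ v _))))
    ...   | same , same-index with f-injective same
    ...     | refl = refl , cong (start i +ⁿ_) (index-injective same-index)

    close : ∀ i → InSquare (v ⊕ (ℤ.- + B , ℤ.- + B)) (suc (2 ^ M)) (initial (Q (centre i)))
    close i =
      let P = initial (curveSeg (f i) 0ℤ)
          x , x≤ , eqx = nonneg-shift (proj₁ P) (ℕₚ.≤-trans (ℕₚ.m≤m+n _ _) (initial-bounded i))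
          y , y≤ , eqy = nonneg-shift (proj₂ P) (ℕₚ.≤-trans (ℕₚ.m≤n+m _ ∣ proj₁ P ∣) (initial-bounded i))
      in x , y , wide x≤ , wide y≤ , (begin
        initial (Q (centre i))                            ≡⟨ cong initial (on-window i (ℕₚ.m≤m+n L L)) ⟩
        v ⊕ initial (curveSeg (f i) (+ L - + L))          ≡⟨ cong (λ z → v ⊕ initial (curveSeg (f i) z)) (ℤₚ.+-inverseʳ (+ L)) ⟩
        v ⊕ P                                             ≡⟨ cong (v ⊕_) (cong₂ _,_ (recentre (proj₁ P) (+ B)) (recentre (proj₂ P) (+ B))) ⟩
        v ⊕ ((ℤ.- + B , ℤ.- + B) ⊕ (proj₁ P + + B , proj₂ P + + B))
                                                          ≡⟨ cong₂ (λ a b → v ⊕ ((ℤ.- + B , ℤ.- + B) ⊕ (a , b))) eqx eqy ⟩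
        v ⊕ ((ℤ.- + B , ℤ.- + B) ⊕ (+ x , + y))           ≡⟨ sym (⊕-assoc v _ _) ⟩
        (v ⊕ (ℤ.- + B , ℤ.- + B)) ⊕ (+ x , + y)           ∎)
      where
      open ≡-Reasoning
      wide : ∀ {x} → x ≤ⁿ B +ⁿ B → x ≤ⁿ suc (2 ^ M)
      wide x≤ = ℕₚ.≤-trans x≤ (ℕₚ.m≤n⇒m≤1+n (n≤2^n M))
      recentre : ∀ a b → a ≡ (ℤ.- b) + (a + b)
      recentre = solve-∀

    no-copy : ⊥
    no-copy = seven-close-indices M ss σ (v ⊕ (ℤ.- + B , ℤ.- + B)) centre deep close separated

  -- Both endpoints of a translated piece lie in the disk, hence in the full square; its edge is
  -- therefore traversed by the curve `a` within the window.
  filled-square : ∀ a ss σ t m r {lo hi c w} → M *ⁿ 2 ≤ⁿ length ss →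
    (∀ j → j ≤ⁿ m → curveSeg a (+ suc j) ≡ walk (paper ss) σ (t +ⁿ j)) →
    t ≤ⁿ lo → hi ≤ⁿ t +ⁿ m → r +ⁿ r ≤ⁿ w → Full (walk (paper ss) σ) lo hi c w →
    (Σ Point λ v → All (λ D → IsDecSegOf C (translateD v D) × DecInDisk (c ⊕ (+ r , + r)) r (translateD v D)) pieces) → ⊥
  filled-square a ss σ t m r {lo} {hi} {c} {w} deep along t≤lo hi≤ 2r≤w full (v , copies) =
    no-copy a ss deep σ t m along v copy
    where
    copy : ∀ i {n} → n < suc (L +ⁿ L) → IsDecSegOf C (translateD v (decorated (curve (f i)) (index n))) ×
      Σ ℕ λ j → j ≤ⁿ m × support (walk (paper ss) σ (t +ⁿ j)) ≡ support (v ⊞ curveSeg (f i) (index n))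
    copy i {n} n< =
      let isDec , initial-in , terminal-in = piece copies i n<
          P , d = v ⊞ curveSeg (f i) (index n)
          k , lo≤k , k<hi , eq = covers-inside {c = c} full P d
            (disk-in-square c r 2r≤w P initial-in) (disk-in-square c r 2r≤w (P ⊕ step d) terminal-in)
      in isDec , k ∸ t ,
         ℕₚ.≤-trans (ℕₚ.∸-monoˡ-≤ t (ℕₚ.≤-trans (ℕₚ.<⇒≤ k<hi) hi≤)) (ℕₚ.≤-reflexive (ℕₚ.m+n∸m≡n t m)) ,
         trans (cong (λ z → support (walk (paper ss) σ z)) (ℕₚ.m+[n∸m]≡n (ℕₚ.≤-trans t≤lo lo≤k))) eq

  not-locally-isomorphic : ¬ LocalIsomorphism C
  not-locally-isomorphic locallyIsomorphic =
    let r , _ , dense = locallyIsomorphic pieces pieces-decorated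
        -- Six coarsenings give side 3, and 2r more give side 2 + 2^(2r), enough for a disk of
        -- radius r.
        N = (r +ⁿ r) +ⁿ 6
        -- Two folds per coarsening, both for the descent of depth `M` and for the `N` levels that
        -- fill the square.
        pad = replicate (M *ⁿ 2 +ⁿ N *ⁿ 2) plus
        ss , pad≤ , t , σ , along = window-walk (curve (f 0F)) (folding (f 0F)) pad (margin N)
        deep = subst (_≤ⁿ length ss) (length-replicate (M *ⁿ 2 +ⁿ N *ⁿ 2)) pad≤
        T , t≤ , ≤t+m = aligned-block N t
        c , full = full-square (r +ⁿ r) ss σ T (ℕₚ.m+n≤o⇒n≤o (M *ⁿ 2) deep)
    in filled-square (f 0F) ss σ t (margin N) r {c = c} (ℕₚ.m+n≤o⇒m≤o (M *ⁿ 2) deep) along t≤ ≤t+m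
         (ℕₚ.≤-trans (n≤2^n (r +ⁿ r)) (ℕₚ.m≤n+m (2 ^ (r +ⁿ r)) 2)) full (dense (c ⊕ (+ r , + r)))

theorem3p12 : ∀ {I : Set} (C : Covering I) → LocalIsomorphism C → AtMost 6 I
theorem3p12 C locallyIsomorphic f f-injective =
  let B , initial-bounded = bounded 7 λ i → norm (initial (CompleteCurve.seg (Covering.curve C (f i)) 0ℤ))
  in SevenCurves.not-locally-isomorphic C f f-injective B initial-bounded locallyIsomorphic
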